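{- For every $n\ge1$ and every $\pi\in\mathrm{NCCP}(n;312)$, $$c\big((\psi\circ\phi^{ -1})(\pi)\big)=\beta(\pi),$$ i.e. the triangle formed by $\psi\circ\phi^{ -1}:\mathrm{NCCP}(n;312)\to\mathrm{NCP}(n)$, the Kreweras complement map $c:\mathrm{NCP}(n)\to\mathrm{NCP}(n)$, and $\beta:\mathrm{NCCP}(n;312)\to\mathrm{NCP}(n)$ is commutative.
   Context: **Noncommutative crossing partitions.** Let $[n]=\{1,\dots,n\}$. A noncommutative crossing partition of $[n]$ is a finite sequence $\pi=(\pi_1,\dots,\pi_l)$, written $\pi_1/\cdots/\pi_l$, of nonempty blocks such that each $p\in[n]$ appears exactly once, each block is written increasingly, and $\max(\pi_i)>\min(\pi_{i+1})$ for $1\le i\le l-1$. $\mathrm{NCCP}(n)$ is the set of these. Concatenating the blocks gives a permutation of $[n]$ in one-line notation which determines $\pi$ (slashes sit exactly at the descents); $\pi$ is identified with this permutation. $\mathrm{NCCP}(n;312)$ is the subset of those $\pi$ whose permutation avoids the pattern $312$. $\mathrm{NCP}(n)$ is the set of $\pi\in\mathrm{NCCP}(n)$ that are non-crossing (no $a<b<c<d$ and $i\neq j$ with $a,c\in\pi_i$, $b,d\in\pi_j$) and canonical ($\min(\pi_l)<\cdots<\min(\pi_1)$). **Maps $\phi$ and $\psi$.** A labeled binary tree with $n$ nodes is a rooted tree in which each node has at most one left child and at most one right child, labeled bijectively by $[n]$ with labels increasing from root to leaves. $\phi$ sends such a tree to the permutation obtained by reading labels in in-order (left subtree, root, right subtree);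 it is a bijection onto $\mathrm{NCCP}(n)$. $\psi$ sends such a tree to the canonical partition obtained by deleting all left edges, taking the labels of each resulting chain of right edges as a block, and arranging blocks with decreasing minima. The map $\psi\circ\phi^{ -1}$ restricts to a bijection $\mathrm{NCCP}(n;312)\to\mathrm{NCP}(n)$. **Kreweras complement $c$.** Place points $1,1',2,2',\dots,n,n'$ clockwise on a circle in this order. For $\pi\in\mathrm{NCP}(n)$ draw the convex hulls of its blocks on the unprimed points; $i'$ and $j'$ are in the same block of $c(\pi)$ iff they lie in the same region of the complement in the disc. Dropping primes and arranging blocks in canonical order (decreasing minima) gives $c(\pi)\in\mathrm{NCP}(n)$. **The map $\beta$.** Let $\omega$ be a sequence of distinct integers; its blocks are its maximal increasing runs (a slash is inserted at each descent). For an entry $i$ of $\omega$, define the sequence $\mu(\omega;i)=(\mu_1<\mu_2<\cdots<\mu_p)$ as follows: $\mu_1=i$, then scan the blocks of $\omega$ lying to the left of the block of $i$ from right to left, and append the maximum of a block whenever it is larger than the last element appended. Define $\lambda_1=\mu(\omega;\min\omega)$; delete the elements of $\lambda_1$ from $\omega$, and (with blocks recomputed for the remaining sequence) let $\lambda_2=\mu(\omega;\min\omega)$ for the new $\omega$; continue until $\omega$ is empty, obtaining $\lambda_1,\dots,\lambda_q$. Then $\beta(\omega)=\lambda_q/\lambda_{q-1}/\cdots/\lambda_1$. For $\omega\in\mathrm{NCCP}(n;312)$ (viewed as a permutation), $\beta(\omega)\in\mathrm{NCP}(n)$. E.g. $\beta(23/15/478/6)=7/68/45/2/13$. -}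

module Defs where

open import Data.Nat.Base using (ℕ; zero; suc; _+_; _*_; _≤_; _<_; _>_; _⊓_; _⊔_)
open import Data.Nat.Properties
  using (_≟_; _<?_; <-trans; <-asym; ≮⇒≥; ≤∧≢⇒<; <⇒≢; suc-injective; ≤-decTotalOrder)
open import Data.Integer.Base as ℤ using (+_)
open import Data.Rational.Base as ℚ using (ℚ; 0ℚ; 1ℚ)
open import Data.Fin.Base using (Fin)
open import Data.List.Base
  using (List; []; _∷_; _++_; concat; map; foldr; length; lookup; reverse; filter;
         takeWhile; applyUpTo)
open import Data.List.NonEmpty.Base using (List⁺; _∷_; _∷⁺_; [_]; toList; head; foldr₁)
open import Data.List.Membership.Propositional using (_∈_)
open import Data.List.Membership.DecPropositional _≟_ using (_∉?_)
open import Data.List.Properties using (foldr-++)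
open import Data.List.Relation.Unary.All as All using (All; []; _∷_)
open import Data.List.Relation.Unary.All.Properties as AllP using (++⁻ˡ)
open import Data.List.Relation.Unary.Any using (Any)
open import Data.List.Relation.Unary.Linked using (Linked)
open import Data.List.Relation.Unary.AllPairs using ([]; _∷_)
open import Data.List.Relation.Unary.Unique.Propositional using (Unique)
import Data.List.Relation.Unary.Unique.Propositional.Properties as Unique
open import Data.List.Relation.Binary.Sublist.Propositional using (_⊆_)
open import Data.List.Relation.Binary.Permutation.Propositional
  using (_↭_; ↭-sym; ↭⇒↭ₛ; ↭-reflexive; ↭-trans)
import Data.List.Relation.Binary.Permutation.Setoid.Properties as PermS
import Data.List.Sort.InsertionSort as InsertionSort
open import Data.Product.Base using (_×_; _,_)
open import Data.Empty using (⊥-elim)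
open import Function.Bundles using (_⇔_)
open import Relation.Nullary using (¬_; yes; no)
open import Relation.Binary.PropositionalEquality
  using (_≡_; _≢_; refl; sym; trans; cong; subst; ≢-sym; setoid)
open import Relation.Binary.Construct.Closure.ReflexiveTransitive using (Star)
import Relation.Binary.Construct.On as On
import Relation.Binary.Construct.Flip.EqAndOrd as Flip

Block : Set
Block = List⁺ ℕ

min max : Block → ℕ
min = foldr₁ _⊓_
max = foldr₁ _⊔_

[_]₁ : ℕ → List ℕ
[ n ]₁ = applyUpTo suc n

-- The one-line notation obtained by concatenating the blocks.
word : List Block → List ℕ
word π = concat (map toList π)

record IsNCCP (n : ℕ) (π : List Block) : Set where
  field
    partition  : word π ↭ [ n ]₁
    increasing : All (λ B → Linked _<_ (toList B)) π
    descents   : Linked (λ B C → max B > min C) π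

-- _⊆_ is the order-preserving sublist relation: c, a, b occur in w at
-- increasing positions.
Avoids312 : List ℕ → Set
Avoids312 w = ∀ {a b c} → (c ∷ a ∷ b ∷ []) ⊆ w → ¬ (a < b × b < c)

record IsNCCP312 (n : ℕ) (π : List Block) : Set where
  field
    isNCCP    : IsNCCP n π
    avoids312 : Avoids312 (word π)

NonCrossing : List Block → Set
NonCrossing π = ∀ (i j : Fin (length π)) → i ≢ j →
  ∀ {a b c d} → a < b → b < c → c < d →
  ¬ ( (a ∈ toList (lookup π i) × c ∈ toList (lookup π i))
    × (b ∈ toList (lookup π j) × d ∈ toList (lookup π j)))

Canonical : List Block → Set
Canonical = Linked (λ B C → min B > min C)

record IsNCP (n : ℕ) (π : List Block) : Set where
  field
    isNCCP      : IsNCCP n π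
    nonCrossing : NonCrossing π
    canonical   : Canonical π

data Tree : Set where
  leaf : Tree
  node : Tree → ℕ → Tree → Tree

-- a ⊏ t : the root of t, if there is one, has a label larger than a.
data _⊏_ (a : ℕ) : Tree → Set where
  leaf : a ⊏ leaf
  node : ∀ {l b r} → a < b → a ⊏ node l b r

data Increasing : Tree → Set where
  leaf : Increasing leaf
  node : ∀ {l a r} → a ⊏ l → a ⊏ r → Increasing l → Increasing r →
         Increasing (node l a r)

φ : Tree → List ℕ
φ leaf         = []
φ (node l a r) = φ l ++ a ∷ φ r

record IsLabeledTree (n : ℕ) (t : Tree) : Set where
  field
    increasing : Increasing t
    labels     : φ t ↭ [ n ]₁

-- Adds x as the first label in in-order: x goes to the end of the left edges
-- starting at the root, above all the larger labels it meets there.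
addFirst : ℕ → Tree → Tree
addFirst x leaf = node leaf x leaf
addFirst x (node l a r) with x <? a
... | yes _ = node leaf x (node l a r)
... | no  _ = node (addFirst x l) a r

-- The inverse of φ; see φ∘φ⁻¹, φ⁻¹∘φ and φ⁻¹-isLabeledTree.
φ⁻¹ : List ℕ → Tree
φ⁻¹ = foldr addFirst leaf

φ-addFirst : ∀ x t → φ (addFirst x t) ≡ x ∷ φ t
φ-addFirst x leaf = refl
φ-addFirst x (node l a r) with x <? a
... | yes _ = refl
... | no  _ = cong (_++ a ∷ φ r) (φ-addFirst x l)

φ∘φ⁻¹ : ∀ w → φ (φ⁻¹ w) ≡ w
φ∘φ⁻¹ []      = refl
φ∘φ⁻¹ (x ∷ w) = trans (φ-addFirst x (φ⁻¹ w)) (cong (x ∷_) (φ∘φ⁻¹ w))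

⊏-labels : ∀ {a t} → a ⊏ t → Increasing t → All (a <_) (φ t)
⊏-labels leaf leaf = []
⊏-labels (node a<b) (node b⊏l b⊏r il ir) =
  AllP.++⁺ (All.map (<-trans a<b) (⊏-labels b⊏l il))
           (a<b ∷ All.map (<-trans a<b) (⊏-labels b⊏r ir))

addFirst-root : ∀ {a t} → a ⊏ t → addFirst a t ≡ node leaf a t
addFirst-root leaf = refl
addFirst-root {a} (node {b = b} a<b) with a <? b
... | yes _   = refl
... | no  a≮b = ⊥-elim (a≮b a<b)

addFirst-left : ∀ {a r s} xs → All (a <_) xs →
  foldr addFirst (node s a r) xs ≡ node (foldr addFirst s xs) a r
addFirst-left [] [] = refl
addFirst-left {a} {r} {s} (x ∷ xs) (a<x ∷ a<xs)
  rewrite addFirst-left {a} {r} {s} xs a<xs with x <? a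
... | yes x<a = ⊥-elim (<-asym x<a a<x)
... | no  _   = refl

φ⁻¹∘φ : ∀ {t} → Increasing t → φ⁻¹ (φ t) ≡ t
φ⁻¹∘φ leaf = refl
φ⁻¹∘φ {node l a r} (node a⊏l a⊏r il ir)
  rewrite foldr-++ addFirst leaf (φ l) (a ∷ φ r) | φ⁻¹∘φ ir | addFirst-root a⊏r
        | addFirst-left {a} {r} {leaf} (φ l) (⊏-labels a⊏l il) | φ⁻¹∘φ il = refl

addFirst-⊏ : ∀ {a x t} → a < x → a ⊏ t → a ⊏ addFirst x t
addFirst-⊏ a<x leaf = node a<x
addFirst-⊏ {x = x} a<x (node {b = b} a<b) with x <? b
... | yes _ = node a<x
... | no  _ = node a<b

addFirst-increasing : ∀ {x t} → All (x ≢_) (φ t) → Increasing t → Increasing (addFirst x t)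
addFirst-increasing _ leaf = node leaf leaf leaf leaf
addFirst-increasing {x} {node l a r} x≢ (node a⊏l a⊏r il ir) with x <? a
... | yes x<a = node leaf (node x<a) leaf (node a⊏l a⊏r il ir)
... | no  x≮a = node (addFirst-⊏ a<x a⊏l) a⊏r (addFirst-increasing (++⁻ˡ (φ l) x≢) il) ir
  where a<x = ≤∧≢⇒< (≮⇒≥ x≮a) (≢-sym (All.head (AllP.++⁻ʳ (φ l) x≢)))

φ⁻¹-increasing : ∀ {w} → Unique w → Increasing (φ⁻¹ w)
φ⁻¹-increasing [] = leaf
φ⁻¹-increasing {x ∷ w} (x≢ ∷ u) =
  addFirst-increasing (subst (All (x ≢_)) (sym (φ∘φ⁻¹ w)) x≢) (φ⁻¹-increasing u)

φ⁻¹-isLabeledTree : ∀ {n w} → w ↭ [ n ]₁ → IsLabeledTree n (φ⁻¹ w)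
φ⁻¹-isLabeledTree {n} {w} p = record
  { increasing = φ⁻¹-increasing
      (PermS.Unique-resp-↭ (setoid ℕ) (↭⇒↭ₛ (↭-sym p))
        (Unique.applyUpTo⁺₁ suc n (λ i<j _ e → <⇒≢ i<j (suc-injective e))))
  ; labels     = ↭-trans (↭-reflexive (φ∘φ⁻¹ w)) p
  }

-- The labels on the chain of right edges starting at the root.
spine : Tree → List ℕ
spine leaf         = []
spine (node l a r) = a ∷ spine r

-- chains t lists the chains of t that remain after deleting all left edges;
-- below t lists those that do not contain the root of t.
mutual
  chains : Tree → List Block
  chains leaf         = []
  chains (node l a r) = (a ∷ spine r) ∷ below (node l a r)

  below : Tree → List Block
  below leaf         = []
  below (node l a r) = chains l ++ below r

open InsertionSort (On.decTotalOrder (Flip.decTotalOrder ≤-decTotalOrder) min)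
  using () renaming (sort to sortByDecreasingMin)

ψ : Tree → List Block
ψ t = sortByDecreasingMin (chains t)

-- The standard library has no real numbers, so the disc is the unit disc of ℚ².  Hulls
-- of finitely many rational points are polygons with rational vertices, so
-- two rational points lie in the same region of their complement in the real
-- disc exactly when a polygonal path with rational vertices joins them there.

Point : Set
Point = ℚ × ℚ

lerp : ℚ → Point → Point → Point
lerp t (x , y) (x′ , y′) =
  (1ℚ ℚ.- t) ℚ.* x ℚ.+ t ℚ.* x′ , (1ℚ ℚ.- t) ℚ.* y ℚ.+ t ℚ.* y′

InDisc : Point → Set
InDisc (x , y) = x ℚ.* x ℚ.+ y ℚ.* y ℚ.≤ 1ℚ

-- The point (cos θ , - sin θ) of the unit circle with tan (θ / 2) = k; it
-- moves clockwise as k increases.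
circlePoint : ℕ → Point
circlePoint k = (+ 1 ℤ.- + (k * k)) ℚ./ suc (k * k) , ℤ.- + (2 * k) ℚ./ suc (k * k)

-- Clockwise order 1, 1′, 2, 2′, …, n, n′.
unprimed primed : ℕ → Point
unprimed i = circlePoint (2 * i)
primed   i = circlePoint (suc (2 * i))

-- The smallest convex set containing the points of the block.
data Hull (B : Block) : Point → Set where
  vertex : ∀ {i} → i ∈ toList B → Hull B (unprimed i)
  convex : ∀ {P Q t} → 0ℚ ℚ.≤ t → t ℚ.≤ 1ℚ → Hull B P → Hull B Q → Hull B (lerp t P Q)

InComplement : List Block → Point → Set
InComplement π P = InDisc P × All (λ B → ¬ Hull B P) π

SegmentInComplement : List Block → Point → Point → Set
SegmentInComplement π P Q = ∀ t → 0ℚ ℚ.≤ t → t ℚ.≤ 1ℚ → InComplement π (lerp t P Q)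

SameRegion : List Block → Point → Point → Set
SameRegion π = Star (SegmentInComplement π)

SameBlock : List Block → ℕ → ℕ → Set
SameBlock π i j = Any (λ B → i ∈ toList B × j ∈ toList B) π

-- The graph of c : NCP(n) → NCP(n), i.e. "c(π) = σ".  The condition `blocks`
-- gives the blocks of σ as sets, and σ ∈ NCP(n) fixes their arrangement, so
-- π determines σ.
record KrewerasComplement (n : ℕ) (π σ : List Block) : Set where
  field
    source : IsNCP n π
    target : IsNCP n σ
    blocks : ∀ {i j} → i ∈ [ n ]₁ → j ∈ [ n ]₁ →
             SameBlock σ i j ⇔ SameRegion π (primed i) (primed j)

runs : List ℕ → List Block
runs []       = []
runs (x ∷ xs) with runs xs
... | []     = [ x ] ∷ []
... | B ∷ Bs with x <? head B
...   | yes _ = (x ∷⁺ B) ∷ Bs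
...   | no  _ = [ x ] ∷ B ∷ Bs

-- scan m Bs is what is appended, when m was appended last and the blocks Bs
-- remain to be scanned, in this order.
scan : ℕ → List Block → List ℕ
scan m [] = []
scan m (B ∷ Bs) with m <? max B
... | yes _ = max B ∷ scan (max B) Bs
... | no  _ = scan m Bs

μ : List ℕ → ℕ → Block
μ ω i = i ∷ scan i (reverse (takeWhile (λ B → i ∉? toList B) (runs ω)))

-- The sequences λ₁, λ₂, …; each step removes at least the minimum of ω, so
-- length ω steps suffice to empty ω.
peel : ℕ → List ℕ → List Block
peel zero       _        = []
peel (suc fuel) []       = []
peel (suc fuel) (x ∷ xs) = λ₁ ∷ peel fuel (filter (_∉? toList λ₁) (x ∷ xs))
  where λ₁ = μ (x ∷ xs) (min (x ∷ xs))

β : List ℕ → List Block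
β ω = reverse (peel (length ω) ω)

{-# OPTIONS --safe #-}
module Submission where

-- For i ≤ j, the points i′ and j′ lie in the same region if and only if the
-- interval (i , j] splits no block: if it splits one, a chord of that block
-- separates i′ from j′, and otherwise the segment from i′ to j′ already avoids
-- all hulls.  Avoiding 312 means that, at every node of the tree, the labels on
-- the left are smaller than those on the right.  Hence β can be computed along
-- the tree: the block begun by a label a consists of a and of the right-to-left
-- maxima of its left subtree.  An induction on the tree then shows that two
-- labels share such a block exactly when the interval between them splits no
-- chain of right edges.

open import Defs
open import Data.Empty using (⊥-elim)
open import Data.Fin.Base as Fin using (Fin)
open import Data.List.Base
  using (List; []; _∷_; _++_; concat; map; length; lookup; reverse; filter; takeWhile)
open import Data.List.Properties
  using (++-assoc; ++-identityʳ; concat-++; map-++; reverse-++; reverse-map; unfold-reverse;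
         length-reverse; filter-++; filter-all; filter-accept; filter-reject; filter-notAll;
         ∷-injective)
open import Data.List.NonEmpty.Base using (_∷_; _∷⁺_; toList; head; foldr₁)
open import Data.List.Membership.Propositional using (_∈_; _∉_; find; lose)
open import Data.List.Membership.Propositional.Properties
  using (∈-++⁺ˡ; ∈-++⁺ʳ; ∈-++⁻; ∈-lookup; ∈-applyUpTo⁻)
open import Data.List.Relation.Unary.All as All using (All; []; _∷_)
import Data.List.Relation.Unary.All.Properties as All
open import Data.List.Relation.Unary.Any as Any using (Any; here; there)
import Data.List.Relation.Unary.Any.Properties as Any
open import Data.List.Relation.Unary.AllPairs as AllPairs using (AllPairs; []; _∷_)
import Data.List.Relation.Unary.AllPairs.Properties as AllPairs
open import Data.List.Relation.Unary.Linked as Linked using (Linked; []; [-]; _∷_)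
import Data.List.Relation.Unary.Linked.Properties as Linked
open import Data.List.Relation.Unary.Unique.Propositional using (Unique)
import Data.List.Relation.Unary.Unique.Propositional.Properties as Unique
open import Data.List.Relation.Binary.Disjoint.Propositional using (Disjoint)
open import Data.List.Relation.Binary.Permutation.Propositional as Perm
  using (_↭_; ↭-refl; ↭-sym; ↭-trans; ↭-prep; ↭-reflexive; ↭⇒↭ₛ; module PermutationReasoning)
import Data.List.Relation.Binary.Permutation.Propositional.Properties as Perm
import Data.List.Relation.Binary.Permutation.Setoid.Properties as PermS
import Data.List.Relation.Binary.Subset.Propositional.Properties as Subset
import Data.List.Relation.Binary.Sublist.Propositional as Sublist
import Data.List.Relation.Binary.Sublist.Propositional.Properties as Sublist
import Data.List.Sort.InsertionSort.Properties as InsertionSort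
import Data.Nat.Base as ℕ
import Data.Nat.Properties as ℕ
open import Data.List.Membership.DecPropositional ℕ._≟_ using (_∉?_)
open import Data.Nat.Base using (ℕ; suc)
open import Data.Product.Base using (_×_; _,_; ∃; ∃₂; proj₁; proj₂)
open import Data.Sum.Base as Sum using (_⊎_; inj₁; inj₂; [_,_]′)
open import Function.Base using (_∘_; id)
open import Function.Bundles using (_⇔_; mk⇔; Equivalence)
open import Relation.Binary.Construct.Closure.ReflexiveTransitive as Star using (ε; _◅_)
import Relation.Binary.Construct.Flip.EqAndOrd as Flip
import Relation.Binary.Construct.On as On
open import Relation.Binary.Definitions using (tri<; tri≈; tri>)
open import Relation.Binary.PropositionalEquality hiding ([_])
open import Relation.Nullary using (¬_; yes; no)
open import Relation.Nullary.Decidable using (_×-dec_; dec-true; dec-false; dec⇒maybe)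
open import Relation.Unary using (Decidable)

-- The interval is half-open because the unprimed points met clockwise between i′ and j′ are exactly
-- i + 1, ..., j. That a chord separates is a claim about all paths; it becomes rational arithmetic
-- through one affine form per chord: a segment on which the form changes sign has a rational zero
-- of it, and inside the disc such a zero lies on the chord itself. The induction on the tree cannot
-- speak of complete blocks only. In a left subtree the block of the last label is still open, since
-- the label of the parent will join it. Blocks are therefore compared with intervals for a tree t
-- together with a pending parent p smaller than every label of t. A pair (p , j) then asks when an
-- initial segment of the labels of t splits no chain, and at the outermost tree p = 0 acts as a
-- virtual parent. Likewise, deleting the block of a label may leave a word that is not the word of
-- a subtree, so peeling is described for such leftovers too.

Unseparated : (ℕ → ℕ → Set) → ℕ → ℕ → Set
Unseparated R i j = ∀ {x y} → R x y → i ℕ.< x → x ℕ.≤ j → i ℕ.< y × y ℕ.≤ j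

sameBlock-sym : ∀ {π i j} → SameBlock π i j → SameBlock π j i
sameBlock-sym = Any.map λ (p , q) → q , p

-- Geometry of the disc: rational points, chords and regions.

module Geometry where
  open import Data.Rational.Base
  open import Data.Rational.Properties
  open import Data.Integer.Base as ℤ using (ℤ; +_)
  import Data.Integer.Properties as ℤ
  import Data.Integer.Tactic.RingSolver as ℤRing
  import Data.Rational.Unnormalised.Base as ℚᵘ
  import Data.Rational.Unnormalised.Properties as ℚᵘ
  open import Tactic.RingSolver.Core.AlmostCommutativeRing
    using (AlmostCommutativeRing; fromCommutativeRing)
  open import Tactic.RingSolver using (solve-∀)

  ℚ-ring : AlmostCommutativeRing _ _
  ℚ-ring = fromCommutativeRing +-*-commutativeRing (λ p → dec⇒maybe (0ℚ ≟ p))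

  -- In the coordinates X = 1 + x, Y = − y, Z = 1 − x the circle is Y² = X Z, the
  -- point with parameter k is a multiple of (1 , k , k²), and the chord through the
  -- points with parameters a and b is Z − (a + b) Y + a b X = 0.
  L : ℚ → ℚ → Point → ℚ
  L a b (x , y) = (1ℚ + - x) + (a + b) * y + (a * b) * (1ℚ + x)

  L-lerp : ∀ a b t P Q → L a b (lerp t P Q) ≡ (1ℚ + - t) * L a b P + t * L a b Q
  L-lerp a b t (x , y) (x′ , y′) = eq a b t x y x′ y′
    where
    eq : ∀ a b t x y x′ y′ →
      (1ℚ + - ((1ℚ + - t) * x + t * x′)) + (a + b) * ((1ℚ + - t) * y + t * y′)
        + (a * b) * (1ℚ + ((1ℚ + - t) * x + t * x′))
      ≡ (1ℚ + - t) * ((1ℚ + - x) + (a + b) * y + (a * b) * (1ℚ + x))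
        + t * ((1ℚ + - x′) + (a + b) * y′ + (a * b) * (1ℚ + x′))
    eq = solve-∀ ℚ-ring

  ι : ℤ → ℚ
  ι i = i / 1

  -- Division in ℚ reduces by a gcd. Equalities of quotients are therefore checked in the
  -- unnormalised rationals, where they are cross multiplications.
  toℚᵘ-/ : ∀ i n → toℚᵘ (i / suc n) ℚᵘ.≃ ℚᵘ.mkℚᵘ i n
  toℚᵘ-/ i n = toℚᵘ-fromℚᵘ (ℚᵘ.mkℚᵘ i n)

  ι-+ : ∀ i j → ι (i ℤ.+ j) ≡ ι i + ι j
  ι-+ i j = toℚᵘ-injective (ℚᵘ.≃-trans (toℚᵘ-/ (i ℤ.+ j) 0) (ℚᵘ.≃-sym
    (ℚᵘ.≃-trans (toℚᵘ-homo-+ (ι i) (ι j))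
      (ℚᵘ.≃-trans (ℚᵘ.+-cong (toℚᵘ-/ i 0) (toℚᵘ-/ j 0)) (ℚᵘ.*≡* (eq i j))))))
    where
    eq : ∀ i j → (i ℤ.* ℤ.1ℤ ℤ.+ j ℤ.* ℤ.1ℤ) ℤ.* ℤ.1ℤ ≡ (i ℤ.+ j) ℤ.* ℤ.1ℤ
    eq = ℤRing.solve-∀

  /-* : ∀ i j m n → (i / suc m) * (j / suc n) ≡ (i ℤ.* j) / (suc m ℕ.* suc n)
  /-* i j m n = toℚᵘ-injective (ℚᵘ.≃-trans (toℚᵘ-homo-* (i / suc m) (j / suc n))
    (ℚᵘ.≃-trans (ℚᵘ.*-cong (toℚᵘ-/ i m) (toℚᵘ-/ j n)) (ℚᵘ.≃-sym (toℚᵘ-/ (i ℤ.* j) _))))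

  /-neg : ∀ i n → (ℤ.- i) / suc n ≡ - (i / suc n)
  /-neg i n = toℚᵘ-injective (ℚᵘ.≃-trans (toℚᵘ-/ (ℤ.- i) n) (ℚᵘ.≃-sym
    (ℚᵘ.≃-trans (toℚᵘ-homo‿- (i / suc n)) (ℚᵘ.-‿cong (toℚᵘ-/ i n)))))

  n/n : ∀ n → (+ suc n) / suc n ≡ 1ℚ
  n/n n = toℚᵘ-injective (ℚᵘ.≃-trans (toℚᵘ-/ (+ suc n) n) (ℚᵘ.*≡* (ℤ.*-comm (+ suc n) ℤ.1ℤ)))

  /-ι : ∀ i n → i / suc n ≡ ι i * (+ 1 / suc n)
  /-ι i n =
    trans (/-cong (sym (ℤ.*-identityʳ i)) (sym (ℕ.*-identityˡ (suc n)))) (sym (/-* i (+ 1) 0 n))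

  ιℕ : ℕ → ℚ
  ιℕ k = ι (+ k)

  ιℕ-* : ∀ m n → ιℕ (m ℕ.* n) ≡ ιℕ m * ιℕ n
  ιℕ-* m n = trans (cong ι (ℤ.pos-* m n)) (sym (/-* (+ m) (+ n) 0 0))

  ιℕ-mono-< : ∀ {m n} → m ℕ.< n → ιℕ m < ιℕ n
  ιℕ-mono-< {m} {n} m<n = toℚᵘ-cancel-<
    (ℚᵘ.<-respˡ-≃ (ℚᵘ.≃-sym (toℚᵘ-/ (+ m) 0))
      (ℚᵘ.<-respʳ-≃ (ℚᵘ.≃-sym (toℚᵘ-/ (+ n) 0))
        (ℚᵘ.*<* (ℤ.*-monoʳ-<-pos ℤ.1ℤ (ℤ.+<+ m<n)))))

  w : ℕ → ℚ
  w k = + 1 / suc (k ℕ.* k)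

  w-inverse : ∀ k → w k * (1ℚ + ιℕ k * ιℕ k) ≡ 1ℚ
  w-inverse k = begin
    w k * (1ℚ + ιℕ k * ιℕ k)     ≡⟨ cong (λ q → w k * (1ℚ + q)) (ιℕ-* k k) ⟨
    w k * (1ℚ + ιℕ (k ℕ.* k))    ≡⟨ cong (w k *_) (ι-+ (+ 1) (+ (k ℕ.* k))) ⟨
    w k * ιℕ (suc (k ℕ.* k))     ≡⟨ *-comm (w k) _ ⟩
    ιℕ (suc (k ℕ.* k)) * w k     ≡⟨ /-ι (+ suc (k ℕ.* k)) (k ℕ.* k) ⟨
    + suc (k ℕ.* k) / suc (k ℕ.* k) ≡⟨ n/n (k ℕ.* k) ⟩
    1ℚ                           ∎
    where open ≡-Reasoning

  w-pos : ∀ k → 0ℚ < w k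
  w-pos k = positive⁻¹ (w k) {{normalize-pos 1 (suc (k ℕ.* k))}}

  -- Keeping the factor d = 1 / (1 + κ²) as an independent variable makes the coordinates
  -- polynomial, within reach of the ring solver; the relation d (1 + κ²) = 1 is supplied afterwards
  -- by `w-inverse`.
  circle : ℚ → ℚ → Point
  circle κ d = (1ℚ + - (κ * κ)) * d , (- (κ + κ)) * d

  circlePoint-eq : ∀ k → circlePoint k ≡ circle (ιℕ k) (w k)
  circlePoint-eq k = cong₂ _,_
    (trans (/-ι (+ 1 ℤ.- + (k ℕ.* k)) (k ℕ.* k)) (cong (_* w k)
       (trans (ι-+ (+ 1) (ℤ.- + (k ℕ.* k)))
           (cong (λ q → 1ℚ + q) (trans (/-neg (+ (k ℕ.* k)) 0) (cong -_ (ιℕ-* k k)))))))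
    (trans (/-ι (ℤ.- + (2 ℕ.* k)) (k ℕ.* k)) (cong (_* w k)
       (trans (/-neg (+ (2 ℕ.* k)) 0)
           (cong -_ (trans (cong (λ m → ιℕ (k ℕ.+ m)) (ℕ.+-identityʳ k)) (ι-+ (+ k) (+ k)))))))

  circle-norm′ : ∀ κ d →
      ((1ℚ + - (κ * κ)) * d) * ((1ℚ + - (κ * κ)) * d) + ((- (κ + κ)) * d) * ((- (κ + κ)) * d)
    ≡ (d * (1ℚ + κ * κ)) * (d * (1ℚ + κ * κ))
  circle-norm′ = solve-∀ ℚ-ring

  -- The last summand carries the defect 1 - d (1 + κ²), which vanishes for `d = w k`.
  L-circle′ : ∀ a b κ d →
     (1ℚ + - ((1ℚ + - (κ * κ)) * d)) + (a + b) * ((- (κ + κ)) * d)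
       + (a * b) * (1ℚ + (1ℚ + - (κ * κ)) * d)
     ≡ (d + d) * ((κ + - a) * (κ + - b)) + (1ℚ + a * b) * (1ℚ + - (d * (1ℚ + κ * κ)))
  L-circle′ = solve-∀ ℚ-ring

  -- On the circle the form is a positive multiple of the quadratic with roots a and b in the
  -- parameter, so its sign tells on which arc a point lies: negative between a and b, positive
  -- outside.
  L-circle : ∀ a b k → L a b (circlePoint k) ≡ (w k + w k) * ((ιℕ k + - a) * (ιℕ k + - b))
  L-circle a b k = begin
    L a b (circlePoint k) ≡⟨ cong (L a b) (circlePoint-eq k) ⟩
    L a b (circle (ιℕ k) (w k)) ≡⟨ L-circle′ a b (ιℕ k) (w k) ⟩
    r + (1ℚ + a * b) * (1ℚ + - (w k * (1ℚ + ιℕ k * ιℕ k)))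
        ≡⟨ cong (λ q → r + (1ℚ + a * b) * (1ℚ + - q)) (w-inverse k) ⟩
    r + (1ℚ + a * b) * 0ℚ ≡⟨ cong (λ q → r + q) (*-zeroʳ (1ℚ + a * b)) ⟩
    r + 0ℚ ≡⟨ +-identityʳ r ⟩
    r ∎
    where
    open ≡-Reasoning
    r = (w k + w k) * ((ιℕ k + - a) * (ιℕ k + - b))

  norm : Point → ℚ
  norm (x , y) = x * x + y * y

  circle-norm : ∀ k → norm (circlePoint k) ≡ 1ℚ
  circle-norm k =
      trans (cong norm (circlePoint-eq k))
        (trans (circle-norm′ (ιℕ k) (w k)) (cong (λ q → q * q) (w-inverse k)))

  0≤p*q : ∀ {p q} → 0ℚ ≤ p → 0ℚ ≤ q → 0ℚ ≤ p * q
  0≤p*q {p} {q} 0≤p 0≤q =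
      nonNegative⁻¹ (p * q) {{nonNeg*nonNeg⇒nonNeg p {{nonNegative 0≤p}} q {{nonNegative 0≤q}}}}

  0<p*q : ∀ {p q} → 0ℚ < p → 0ℚ < q → 0ℚ < p * q
  0<p*q {p} {q} 0<p 0<q = positive⁻¹ (p * q) {{pos*pos⇒pos p {{positive 0<p}} q {{positive 0<q}}}}

  p*q<0 : ∀ {p q} → 0ℚ < p → q < 0ℚ → p * q < 0ℚ
  p*q<0 {p} {q} 0<p q<0 = negative⁻¹ (p * q) {{pos*neg⇒neg p {{positive 0<p}} q {{negative q<0}}}}

  0≤p*p : ∀ p → 0ℚ ≤ p * p
  0≤p*p p with ≤-total 0ℚ p
  ... | inj₁ 0≤p = 0≤p*q 0≤p 0≤p
  ... | inj₂ p≤0 = subst (0ℚ ≤_) (eq p) (0≤p*q (neg-antimono-≤ p≤0) (neg-antimono-≤ p≤0))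
    where
    eq : ∀ p → - p * - p ≡ p * p
    eq = solve-∀ ℚ-ring

  p≤q⇒0≤q-p : ∀ {p q} → p ≤ q → 0ℚ ≤ q - p
  p≤q⇒0≤q-p {p} {q} p≤q = subst (_≤ q - p) (+-inverseʳ p) (+-monoˡ-≤ (- p) p≤q)

  p<q⇒0<q-p : ∀ {p q} → p < q → 0ℚ < q - p
  p<q⇒0<q-p {p} {q} p<q = subst (_< q - p) (+-inverseʳ p) (+-monoˡ-< (- p) p<q)

  p<q⇒p-q<0 : ∀ {p q} → p < q → p - q < 0ℚ
  p<q⇒p-q<0 {p} {q} p<q = subst (p - q <_) (+-inverseʳ q) (+-monoˡ-< (- q) p<q)

  0≤q-p⇒p≤q : ∀ {p q} → 0ℚ ≤ q - p → p ≤ q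
  0≤q-p⇒p≤q {p} {q} h = subst₂ _≤_ (+-identityˡ p) (eq p q) (+-monoˡ-≤ p h)
    where
    eq : ∀ p q → (q + - p) + p ≡ q
    eq = solve-∀ ℚ-ring

  -- |lerp t P Q|² = 1 − t (1 − t) |P − Q|² on the unit circle
  chord-inDisc : ∀ {P Q t} → norm P ≡ 1ℚ → norm Q ≡ 1ℚ → 0ℚ ≤ t → t ≤ 1ℚ → InDisc (lerp t P Q)
  chord-inDisc {x , y} {x′ , y′} {t} p q 0≤t t≤1 = 0≤q-p⇒p≤q (subst (0ℚ ≤_) e
    (0≤p*q (0≤p*q 0≤t (p≤q⇒0≤q-p t≤1)) (+-mono-≤ (0≤p*p (x + - x′)) (0≤p*p (y + - y′)))))
    where
    eq : ∀ t x y x′ y′ →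
      (t * (1ℚ + - t)) * ((x + - x′) * (x + - x′) + (y + - y′) * (y + - y′))
      ≡ ((1ℚ + - t) * (x * x + y * y) + t * (x′ * x′ + y′ * y′))
        + - (((1ℚ + - t) * x + t * x′) * ((1ℚ + - t) * x + t * x′)
             + ((1ℚ + - t) * y + t * y′) * ((1ℚ + - t) * y + t * y′))
    eq = solve-∀ ℚ-ring
    eq′ : ∀ t → (1ℚ + - t) * 1ℚ + t * 1ℚ ≡ 1ℚ
    eq′ = solve-∀ ℚ-ring
    e = trans (eq t x y x′ y′) (cong (λ q → q + - norm (lerp t (x , y) (x′ , y′)))
       (trans (cong₂ (λ u v → (1ℚ + - t) * u + t * v) p q) (eq′ t)))

  -- A negative p would force q to be positive through the sum, and then the product would be
  -- negative.
  0≤p*q⇒0≤p : ∀ {p q} → 0ℚ ≤ p * q → 0ℚ ≤ p + q → 0ℚ ≤ p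
  0≤p*q⇒0≤p {p} {q} pq p+q with <-cmp p 0ℚ
  ... | tri≈ _ refl _ = ≤-refl
  ... | tri> _ _ 0<p = <⇒≤ 0<p
  ... | tri< p<0 _ _ =
      ⊥-elim (<-irrefl refl (≤-<-trans pq (subst (_< 0ℚ) (*-comm q p) (p*q<0 0<q p<0))))
    where
    eq : ∀ p q → (p + q) + - p ≡ q
    eq = solve-∀ ℚ-ring
    0<q : 0ℚ < q
    0<q = subst (0ℚ <_) (eq p q)
        (≤-<-trans p+q
          (subst (_< (p + q) + - p) (+-identityʳ (p + q))
          (+-monoʳ-< (p + q) (neg-antimono-< p<0))))

  inverse-of-pos : ∀ {p} → 0ℚ < p → ∃ λ e → 0ℚ < e × e * p ≡ 1ℚ
  inverse-of-pos {p} 0<p = 1/ p , positive⁻¹ (1/ p) {{1/pos⇒pos p {{p-pos}}}} , *-inverseˡ p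
    where instance
    p-pos : Positive p
    p-pos = positive 0<p
    p≢0 : NonZero p
    p≢0 = pos⇒nonZero p

  module _ {a b x y : ℚ} (a<b : a < b) (disc : InDisc (x , y)) (L≡0 : L a b (x , y) ≡ 0ℚ) where
    private
      -- On the chord u v = 1 − |P|², while u + v = (b − a) (1 + x); so u and v are
      -- nonnegative, and they are the weights of P up to positive factors.
      u v : ℚ
      u = - y + - (a * (1ℚ + x))
      v = b * (1ℚ + x) + - - y

      0≤1-norm : 0ℚ ≤ 1ℚ - norm (x , y)
      0≤1-norm = p≤q⇒0≤q-p disc

      0≤1+x : 0ℚ ≤ 1ℚ + x
      -- The product (1 + x)(1 - x) is (1 - |P|²) + y², and the sum of the factors is 2.
      0≤1+x = 0≤p*q⇒0≤p {1ℚ + x} {1ℚ + - x}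
        (subst (0ℚ ≤_) (eq x y) (+-mono-≤ 0≤1-norm (0≤p*p y)))
        (subst (0ℚ ≤_) (eq′ x) (*≤* (ℤ.+≤+ ℕ.z≤n)))
        where
        eq : ∀ x y → (1ℚ + - (x * x + y * y)) + y * y ≡ (1ℚ + x) * (1ℚ + - x)
        eq = solve-∀ ℚ-ring
        eq′ : ∀ x → 1ℚ + 1ℚ ≡ (1ℚ + x) + (1ℚ + - x)
        eq′ = solve-∀ ℚ-ring

      0≤u*v : 0ℚ ≤ u * v
      0≤u*v = subst (0ℚ ≤_) (trans (sym drop-L) (eq a b x y)) 0≤1-norm
        where
        eq : ∀ a b x y →
          (1ℚ + - (x * x + y * y))
            + - ((1ℚ + x) * ((1ℚ + - x) + (a + b) * y + (a * b) * (1ℚ + x)))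
          ≡ (- y + - (a * (1ℚ + x))) * (b * (1ℚ + x) + - - y)
        eq = solve-∀ ℚ-ring
        drop-L : (1ℚ + - norm (x , y)) + - ((1ℚ + x) * L a b (x , y)) ≡ 1ℚ + - norm (x , y)
        drop-L = trans (cong (λ l → (1ℚ + - norm (x , y)) + - ((1ℚ + x) * l)) L≡0)
          (trans (cong (λ l → (1ℚ + - norm (x , y)) + - l) (*-zeroʳ (1ℚ + x)))
            (+-identityʳ (1ℚ + - norm (x , y))))

      0≤u+v : 0ℚ ≤ u + v
      0≤u+v = subst (0ℚ ≤_) (eq a b x y) (0≤p*q (<⇒≤ (p<q⇒0<q-p a<b)) 0≤1+x)
        where
        eq : ∀ a b x y → (b + - a) * (1ℚ + x) ≡ (- y + - (a * (1ℚ + x))) + (b * (1ℚ + x) + - - y)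
        eq = solve-∀ ℚ-ring

      0≤u : 0ℚ ≤ u
      0≤u = 0≤p*q⇒0≤p {u} {v} 0≤u*v 0≤u+v

      0≤v : 0ℚ ≤ v
      0≤v = 0≤p*q⇒0≤p {v} {u} (subst (0ℚ ≤_) (*-comm u v) 0≤u*v)
          (subst (0ℚ ≤_) (+-comm u v) 0≤u+v)

    -- Converse to the convexity of the disc: the line through the two circle points meets the disc
    -- in nothing but their chord. This prevents a path from getting round the ends of the chord.
    onChord : ∀ {d d′} → d * (1ℚ + a * a) ≡ 1ℚ → d′ * (1ℚ + b * b) ≡ 1ℚ →
      ∃ λ t → 0ℚ ≤ t × t ≤ 1ℚ × (x , y) ≡ lerp t (circle a d) (circle b d′)
    onChord {d} {d′} hd hd′ with inverse-of-pos (p<q⇒0<q-p a<b)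
    ... | e , 0<e , he = t , 0≤t , 0≤q-p⇒p≤q (subst (0ℚ ≤_) s≡1-t 0≤s) , sym (cong₂ _,_ ex ey)
      where
      open ≡-Reasoning
      -- Here e = 1 / (b - a). Solving (X , Y , Z) = 2p (1 , a , a²) + 2q (1 , b , b²) gives p and q
      -- as below. The endpoints are 2d (1 , a , a²) and 2d′ (1 , b , b²), so the weights become p /
      -- d = s and q / d′ = t.
      p q s t : ℚ
      p = ½ * (e * v)
      q = ½ * (e * u)
      s = p * (1ℚ + a * a)
      t = q * (1ℚ + b * b)

      0≤½*e : ∀ {r} → 0ℚ ≤ r → 0ℚ ≤ ½ * (e * r)
      0≤½*e {r} 0≤r = 0≤p*q {½} {e * r} (*≤* (ℤ.+≤+ ℕ.z≤n)) (0≤p*q (<⇒≤ 0<e) 0≤r)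

      0≤1+ : ∀ r → 0ℚ ≤ 1ℚ + r * r
      0≤1+ r = +-mono-≤ {0ℚ} {1ℚ} {0ℚ} (*≤* (ℤ.+≤+ ℕ.z≤n)) (0≤p*p r)

      0≤s : 0ℚ ≤ s
      0≤s = 0≤p*q (0≤½*e 0≤v) (0≤1+ a)

      0≤t : 0ℚ ≤ t
      0≤t = 0≤p*q (0≤½*e 0≤u) (0≤1+ b)

      p+q : (p + p) + (q + q) ≡ 1ℚ + x
      p+q = begin
        (p + p) + (q + q) ≡⟨ eq ½ a b e x y ⟩
        (½ + ½) * ((e * (b + - a)) * (1ℚ + x)) ≡⟨ cong (λ r → 1ℚ * (r * (1ℚ + x))) he ⟩
        1ℚ * (1ℚ * (1ℚ + x)) ≡⟨ trans (*-identityˡ (1ℚ * (1ℚ + x))) (*-identityˡ (1ℚ + x)) ⟩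
        1ℚ + x ∎
        where
        eq : ∀ h a b e x y →
          let p = h * (e * (b * (1ℚ + x) + - - y))
              q = h * (e * (- y + - (a * (1ℚ + x))))
          in
          (p + p) + (q + q) ≡ (h + h) * ((e * (b + - a)) * (1ℚ + x))
        eq = solve-∀ ℚ-ring

      pa+qb : (p + p) * a + (q + q) * b ≡ - y
      pa+qb = begin
        (p + p) * a + (q + q) * b ≡⟨ eq ½ a b e x y ⟩
        (½ + ½) * ((e * (b + - a)) * (- y)) ≡⟨ cong (λ r → 1ℚ * (r * (- y))) he ⟩
        1ℚ * (1ℚ * (- y)) ≡⟨ trans (*-identityˡ (1ℚ * (- y))) (*-identityˡ (- y)) ⟩
        - y ∎
        where
        eq : ∀ h a b e x y →
          let p = h * (e * (b * (1ℚ + x) + - - y))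
              q = h * (e * (- y + - (a * (1ℚ + x))))
          in
          (p + p) * a + (q + q) * b ≡ (h + h) * ((e * (b + - a)) * (- y))
        eq = solve-∀ ℚ-ring

      halve : ∀ {r z} → r + r ≡ z + z → r ≡ z
      halve {r} {z} r+r = trans (eq r) (trans (cong (½ *_) r+r) (sym (eq z)))
        where
        eq : ∀ r → r ≡ ½ * (r + r)
        eq r = trans (sym (*-identityˡ r)) (trans (*-distribʳ-+ r ½ ½) (sym (*-distribˡ-+ ½ r r)))

      paa+qbb : (p + p) * (a * a) + (q + q) * (b * b) ≡ 1ℚ + - x
      paa+qbb = begin
        (p + p) * (a * a) + (q + q) * (b * b) ≡⟨ eq ½ a b e x y ⟩
        (½ + ½) * ((e * (b + - a)) * ((1ℚ + - x) + - L a b (x , y)))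
            ≡⟨ cong₂ (λ r l → 1ℚ * (r * ((1ℚ + - x) + - l))) he L≡0 ⟩
        1ℚ * (1ℚ * ((1ℚ + - x) + 0ℚ))
            ≡⟨ trans (*-identityˡ (1ℚ * ((1ℚ + - x) + 0ℚ)))
              (trans (*-identityˡ ((1ℚ + - x) + 0ℚ)) (+-identityʳ (1ℚ + - x))) ⟩
        1ℚ + - x ∎
        where
        eq : ∀ h a b e x y →
          let p = h * (e * (b * (1ℚ + x) + - - y))
              q = h * (e * (- y + - (a * (1ℚ + x))))
          in
          (p + p) * (a * a) + (q + q) * (b * b)
            ≡ (h + h) * ((e * (b + - a))
                * ((1ℚ + - x) + - ((1ℚ + - x) + (a + b) * y + (a * b) * (1ℚ + x))))
        eq = solve-∀ ℚ-ring

      s+t : s + t ≡ 1ℚ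
      -- X + Z = 2 in these coordinates, and it equals 2 (s + t). The coordinate x is recovered
      -- below in the same way from X - Z = 2x.
      s+t = halve (trans (eq a b p q) (trans (cong₂ _+_ p+q paa+qbb) (eq′ x)))
        where
        eq : ∀ a b p q →
            (p * (1ℚ + a * a) + q * (1ℚ + b * b)) + (p * (1ℚ + a * a) + q * (1ℚ + b * b)) ≡
          ((p + p) + (q + q)) + ((p + p) * (a * a) + (q + q) * (b * b))
        eq = solve-∀ ℚ-ring
        eq′ : ∀ x → (1ℚ + x) + (1ℚ + - x) ≡ 1ℚ + 1ℚ
        eq′ = solve-∀ ℚ-ring

      s≡1-t : s ≡ 1ℚ - t
      s≡1-t = trans (eq s t) (cong (_+ - t) s+t)
        where
        eq : ∀ s t → s ≡ (s + t) + - t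
        eq = solve-∀ ℚ-ring

      ex : (1ℚ + - t) * ((1ℚ + - (a * a)) * d) + t * ((1ℚ + - (b * b)) * d′) ≡ x
      ex = begin
        (1ℚ + - t) * ((1ℚ + - (a * a)) * d) + t * ((1ℚ + - (b * b)) * d′)
            ≡⟨ cong (λ r → r * ((1ℚ + - (a * a)) * d) + t * ((1ℚ + - (b * b)) * d′)) s≡1-t ⟨
        s * ((1ℚ + - (a * a)) * d) + t * ((1ℚ + - (b * b)) * d′) ≡⟨ eq a b d d′ p q ⟩
        (1ℚ + - (a * a)) * p * (d * (1ℚ + a * a)) + (1ℚ + - (b * b)) * q * (d′ * (1ℚ + b * b))
            ≡⟨ cong₂ (λ r z → (1ℚ + - (a * a)) * p * r + (1ℚ + - (b * b)) * q * z) hd hd′ ⟩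
        (1ℚ + - (a * a)) * p * 1ℚ + (1ℚ + - (b * b)) * q * 1ℚ
            ≡⟨ halve (trans (eq′ a b p q) (trans (cong₂ (λ r z → r + - z) p+q paa+qbb) (eq″ x))) ⟩
        x ∎
        where
        eq : ∀ a b d d′ p q →
            p * (1ℚ + a * a) * ((1ℚ + - (a * a)) * d) + q * (1ℚ + b * b) * ((1ℚ + - (b * b)) * d′)
          ≡ (1ℚ + - (a * a)) * p * (d * (1ℚ + a * a)) + (1ℚ + - (b * b)) * q * (d′ * (1ℚ + b * b))
        eq = solve-∀ ℚ-ring
        eq′ : ∀ a b p q →
            ((1ℚ + - (a * a)) * p * 1ℚ + (1ℚ + - (b * b)) * q * 1ℚ) +
              ((1ℚ + - (a * a)) * p * 1ℚ + (1ℚ + - (b * b)) * q * 1ℚ)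
          ≡ ((p + p) + (q + q)) + - ((p + p) * (a * a) + (q + q) * (b * b))
        eq′ = solve-∀ ℚ-ring
        eq″ : ∀ x → (1ℚ + x) + - (1ℚ + - x) ≡ x + x
        eq″ = solve-∀ ℚ-ring

      ey : (1ℚ + - t) * (- (a + a) * d) + t * (- (b + b) * d′) ≡ y
      ey = begin
        (1ℚ + - t) * (- (a + a) * d) + t * (- (b + b) * d′)
            ≡⟨ cong (λ r → r * (- (a + a) * d) + t * (- (b + b) * d′)) s≡1-t ⟨
        s * (- (a + a) * d) + t * (- (b + b) * d′) ≡⟨ eq a b d d′ p q ⟩
        - (((p + p) * a) * (d * (1ℚ + a * a)) + ((q + q) * b) * (d′ * (1ℚ + b * b)))
            ≡⟨ cong₂ (λ r z → - (((p + p) * a) * r + ((q + q) * b) * z)) hd hd′ ⟩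
        - (((p + p) * a) * 1ℚ + ((q + q) * b) * 1ℚ)
            ≡⟨ cong₂ (λ r z → - (r + z)) (*-identityʳ ((p + p) * a)) (*-identityʳ ((q + q) * b)) ⟩
        - ((p + p) * a + (q + q) * b) ≡⟨ cong -_ pa+qb ⟩
        - - y ≡⟨ eq′ y ⟩
        y ∎
        where
        eq : ∀ a b d d′ p q →
            p * (1ℚ + a * a) * (- (a + a) * d) + q * (1ℚ + b * b) * (- (b + b) * d′)
          ≡ - (((p + p) * a) * (d * (1ℚ + a * a)) + ((q + q) * b) * (d′ * (1ℚ + b * b)))
        eq = solve-∀ ℚ-ring
        eq′ : ∀ y → - - y ≡ y
        eq′ = solve-∀ ℚ-ring

  -- Sides of a chord: segments that avoid all hulls, and paths that cannot cross one.

  module _ {k a b : ℕ} where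
    L-between : a ℕ.< k → k ℕ.< b → L (ιℕ a) (ιℕ b) (circlePoint k) < 0ℚ
    L-between a<k k<b = subst (_< 0ℚ) (sym (L-circle (ιℕ a) (ιℕ b) k))
      (p*q<0 (+-mono-< (w-pos k) (w-pos k))
          (p*q<0 (p<q⇒0<q-p (ιℕ-mono-< a<k)) (p<q⇒p-q<0 (ιℕ-mono-< k<b))))

    L-above : a ℕ.< k → b ℕ.< k → 0ℚ < L (ιℕ a) (ιℕ b) (circlePoint k)
    L-above a<k b<k = subst (0ℚ <_) (sym (L-circle (ιℕ a) (ιℕ b) k))
      (0<p*q (+-mono-< (w-pos k) (w-pos k))
          (0<p*q (p<q⇒0<q-p (ιℕ-mono-< a<k)) (p<q⇒0<q-p (ιℕ-mono-< b<k))))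

    L-below : k ℕ.< a → k ℕ.< b → 0ℚ < L (ιℕ a) (ιℕ b) (circlePoint k)
    L-below k<a k<b = subst (0ℚ <_) (sym (L-circle (ιℕ a) (ιℕ b) k))
      (0<p*q (+-mono-< (w-pos k) (w-pos k)) (subst (0ℚ <_) (eq (ιℕ k) (ιℕ a) (ιℕ b))
        (0<p*q (p<q⇒0<q-p (ιℕ-mono-< k<a)) (p<q⇒0<q-p (ιℕ-mono-< k<b)))))
      where
      eq : ∀ k a b → (a + - k) * (b + - k) ≡ (k + - a) * (k + - b)
      eq = solve-∀ ℚ-ring

  -- Writing the combination as the smaller of the two values plus a nonnegative term keeps the
  -- inequality strict even at t = 0 and t = 1.
  convex-pos : ∀ {t p q} → 0ℚ ≤ t → t ≤ 1ℚ → 0ℚ < p → 0ℚ < q → 0ℚ < (1ℚ - t) * p + t * q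
  convex-pos {t} {p} {q} 0≤t t≤1 0<p 0<q with ≤-total p q
  ... | inj₁ p≤q = subst (0ℚ <_) (eq t p q) (+-mono-<-≤ 0<p (0≤p*q 0≤t (p≤q⇒0≤q-p p≤q)))
    where
    eq : ∀ t p q → p + t * (q + - p) ≡ (1ℚ + - t) * p + t * q
    eq = solve-∀ ℚ-ring
  ... | inj₂ q≤p =
      subst (0ℚ <_) (eq t p q) (+-mono-<-≤ 0<q (0≤p*q (p≤q⇒0≤q-p t≤1) (p≤q⇒0≤q-p q≤p)))
    where
    eq : ∀ t p q → q + (1ℚ + - t) * (p + - q) ≡ (1ℚ + - t) * p + t * q
    eq = solve-∀ ℚ-ring

  -- The factor `c` serves as a sign, so that a single induction over the hull treats both sides of
  -- the line.
  hull-pos : ∀ {B a b c} → (∀ {x} → x ∈ toList B → 0ℚ < c * L a b (unprimed x)) → ∀ {P} →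
      Hull B P → 0ℚ < c * L a b P
  hull-pos h (vertex x∈B) = h x∈B
  hull-pos {a = a} {b} {c} h (convex {P} {Q} {t} 0≤t t≤1 hP hQ) =
    subst (0ℚ <_) (trans (eq c t (L a b P) (L a b Q)) (cong (c *_) (sym (L-lerp a b t P Q))))
      (convex-pos 0≤t t≤1 (hull-pos {a = a} {b} {c} h hP) (hull-pos {a = a} {b} {c} h hQ))
    where
    eq : ∀ c t p q → (1ℚ + - t) * (c * p) + t * (c * q) ≡ c * ((1ℚ + - t) * p + t * q)
    eq = solve-∀ ℚ-ring

  i<x⇒i′<x : ∀ {i x} → i ℕ.< x → suc (2 ℕ.* i) ℕ.< 2 ℕ.* x
  i<x⇒i′<x {i} {x} i<x = subst (ℕ._≤ 2 ℕ.* x) (ℕ.*-suc 2 i) (ℕ.*-monoʳ-≤ 2 i<x)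

  x≤i⇒x<i′ : ∀ {i x} → x ℕ.≤ i → 2 ℕ.* x ℕ.< suc (2 ℕ.* i)
  x≤i⇒x<i′ x≤i = ℕ.s≤s (ℕ.*-monoʳ-≤ 2 x≤i)

  L-circle-root : ∀ {a b} k → a ≡ ιℕ k ⊎ b ≡ ιℕ k → L a b (circlePoint k) ≡ 0ℚ
  L-circle-root {a} {b} k r =
      trans (L-circle a b k) (trans (cong ((w k + w k) *_) (root r)) (*-zeroʳ (w k + w k)))
    where
    root : a ≡ ιℕ k ⊎ b ≡ ιℕ k → (ιℕ k - a) * (ιℕ k - b) ≡ 0ℚ
    root (inj₁ refl) = trans (cong (_* (ιℕ k - b)) (+-inverseʳ (ιℕ k))) (*-zeroˡ (ιℕ k - b))
    root (inj₂ refl) = trans (cong ((ιℕ k - a) *_) (+-inverseʳ (ιℕ k))) (*-zeroʳ (ιℕ k - a))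

  -- The form of the chord from i′ to j′ vanishes on the segment, whereas the vertices of each
  -- block, and hence its hull, lie strictly on one side.
  unseparated⇒segment : ∀ {π i j} → i ℕ.≤ j → Unseparated (SameBlock π) i j →
    SegmentInComplement π (primed i) (primed j)
  unseparated⇒segment {π} {i} {j} i≤j uns t 0≤t t≤1 =
    chord-inDisc {primed i} {primed j} (circle-norm (suc (2 ℕ.* i)))
        (circle-norm (suc (2 ℕ.* j))) 0≤t t≤1 , All.tabulate avoids
    where
    a = ιℕ (suc (2 ℕ.* i))
    b = ιℕ (suc (2 ℕ.* j))
    R = lerp t (primed i) (primed j)
    L-R≡0 : L a b R ≡ 0ℚ
    L-R≡0 = trans (L-lerp a b t (primed i) (primed j))
      (trans (cong₂ (λ p q → (1ℚ + - t) * p + t * q)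
               (L-circle-root {a} {b} (suc (2 ℕ.* i)) (inj₁ refl))
               (L-circle-root {a} {b} (suc (2 ℕ.* j)) (inj₂ refl)))
        (cong₂ _+_ (*-zeroʳ (1ℚ + - t)) (*-zeroʳ t)))
    off : ∀ {B c} → (∀ {x} → x ∈ toList B → 0ℚ < c * L a b (unprimed x)) → ¬ Hull B R
    off {B} {c} h hR =
        <-irrefl (sym (trans (cong (c *_) L-R≡0) (*-zeroʳ c))) (hull-pos {B} {a} {b} {c} h hR)
    avoids : ∀ {B} → B ∈ π → ¬ Hull B R
    -- The first label decides for the whole block: if it lies in (i , j], so do all the others and
    -- the form is negative on them; if not, none does and the form is positive.
    avoids {B@(h ∷ _)} B∈π with (i ℕ.<? h) ×-dec (h ℕ.≤? j)
    ... | yes (i<h , h≤j) = off {B} { - 1ℚ} λ {x} x∈B →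
      let i<x , x≤j = uns (lose B∈π (here refl , x∈B)) i<h h≤j in
      subst (0ℚ <_) (eq (L a b (unprimed x)))
          (neg-antimono-< (L-between (i<x⇒i′<x i<x) (x≤i⇒x<i′ x≤j)))
      where
      eq : ∀ q → - q ≡ (- 1ℚ) * q
      eq = solve-∀ ℚ-ring
    ... | no ¬in = off {B} {1ℚ} λ {x} x∈B →
        subst (0ℚ <_) (sym (*-identityˡ (L a b (unprimed x)))) (outside x∈B)
      where
      outside : ∀ {x} → x ∈ toList B → 0ℚ < L a b (unprimed x)
      outside {x} x∈B with i ℕ.<? x | x ℕ.≤? j
      ... | yes i<x | yes x≤j = ⊥-elim (¬in (uns (lose B∈π (x∈B , here refl)) i<x x≤j))
      ... | no i≮x | _ = L-below (x≤i⇒x<i′ x≤i) (x≤i⇒x<i′ (ℕ.≤-trans x≤i i≤j))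
        where x≤i = ℕ.≮⇒≥ i≮x
      ... | yes i<x | no x≰j = L-above (i<x⇒i′<x i<x) (i<x⇒i′<x (ℕ.≰⇒> x≰j))

  -- The zero is at t = -p / (q - p), so the crossing point is again rational.
  affine-root : ∀ {p q} → p < 0ℚ → 0ℚ ≤ q →
    ∃ λ t → 0ℚ ≤ t × t ≤ 1ℚ × (1ℚ + - t) * p + t * q ≡ 0ℚ
  affine-root {p} {q} p<0 0≤q with inverse-of-pos (p<q⇒0<q-p (<-≤-trans p<0 0≤q))
  ... | e , 0<e , he = t , 0≤t , t≤1 , root
    where
    t : ℚ
    t = e * - p
    0≤t : 0ℚ ≤ t
    0≤t = 0≤p*q (<⇒≤ 0<e) (<⇒≤ (neg-antimono-< p<0))
    t≤1 : t ≤ 1ℚ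
    t≤1 = 0≤q-p⇒p≤q (subst (0ℚ ≤_) (trans (eq e p q) (cong (_+ - t) he)) (0≤p*q (<⇒≤ 0<e) 0≤q))
      where
      eq : ∀ e p q → e * q ≡ e * (q + - p) + - (e * - p)
      eq = solve-∀ ℚ-ring
    root : (1ℚ + - t) * p + t * q ≡ 0ℚ
    root = trans (eq e p q) (trans (cong (λ r → p + - p * r) he)
      (trans (cong (λ r → p + r) (*-identityʳ (- p))) (+-inverseʳ p)))
      where
      eq : ∀ e p q → (1ℚ + - (e * - p)) * p + e * - p * q ≡ p + - p * (e * (q + - p))
      eq = solve-∀ ℚ-ring

  module _ {π : List Block} {x y : ℕ} (same : SameBlock π x y) (x<y : x ℕ.< y) where
    private
      a = ιℕ (2 ℕ.* x)
      b = ιℕ (2 ℕ.* y)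
      a<b : a < b
      a<b = ιℕ-mono-< (ℕ.*-monoʳ-< 2 x<y)

    chord⊆hull : ∀ {B R t} → x ∈ toList B → y ∈ toList B → 0ℚ ≤ t → t ≤ 1ℚ →
      R ≡ lerp t (circle a (w (2 ℕ.* x))) (circle b (w (2 ℕ.* y))) → Hull B R
    chord⊆hull {B} {R} {t} x∈B y∈B 0≤t t≤1 R≡ = subst (Hull B) (sym R≡chord)
        (convex {P = unprimed x} {unprimed y} {t} 0≤t t≤1 (vertex x∈B) (vertex y∈B))
      where
      R≡chord : R ≡ lerp t (unprimed x) (unprimed y)
      R≡chord = trans R≡
          (cong₂ (lerp t) (sym (circlePoint-eq (2 ℕ.* x))) (sym (circlePoint-eq (2 ℕ.* y))))

    chord-blocks : ∀ {R} → InComplement π R → L a b R ≢ 0ℚ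
    chord-blocks {R} (disc , avoid) L≡0 =
      let B , B∈π , x∈B , y∈B = find same
          t , 0≤t , t≤1 , R≡ = onChord {a} {b} a<b disc L≡0
            {w (2 ℕ.* x)} {w (2 ℕ.* y)} (w-inverse (2 ℕ.* x)) (w-inverse (2 ℕ.* y))
      in All.lookup avoid B∈π (chord⊆hull {B} {R} {t} x∈B y∈B 0≤t t≤1 R≡)

    -- Leaving the negative side would produce a zero of the form on the segment, that is, a point
    -- of the disc on the chord and thus in the hull of the block.
    segment-side : ∀ {P Q} → SegmentInComplement π P Q → L a b P < 0ℚ → L a b Q < 0ℚ
    segment-side {P} {Q} seg p<0 = ≰⇒> λ 0≤q →
      let t , 0≤t , t≤1 , t-root = affine-root {p} {q} p<0 0≤q
      in chord-blocks {lerp t P Q} (seg t 0≤t t≤1) (trans (L-lerp a b t P Q) t-root)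
      where
      p = L a b P
      q = L a b Q

    path-side : ∀ {P Q} → SameRegion π P Q → L a b P < 0ℚ → L a b Q < 0ℚ
    path-side ε LP<0 = LP<0
    path-side (seg ◅ path) LP<0 = path-side path (segment-side seg LP<0)

  sameRegion-sym : ∀ {π P Q} → SameRegion π P Q → SameRegion π Q P
  sameRegion-sym {π} = Star.reverse λ {P} {Q} seg t 0≤t t≤1 →
    subst (InComplement π) (lerp-flip P Q t)
        (seg (1ℚ - t) (p≤q⇒0≤q-p t≤1) (0≤q-p⇒p≤q (subst (0ℚ ≤_) (eq′ t) 0≤t)))
    where
    eq′ : ∀ t → t ≡ 1ℚ + - (1ℚ + - t)
    eq′ = solve-∀ ℚ-ring
    eq : ∀ t x y → (1ℚ + - (1ℚ + - t)) * x + (1ℚ + - t) * y ≡ (1ℚ + - t) * y + t * x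
    eq = solve-∀ ℚ-ring
    lerp-flip : ∀ P Q t → lerp (1ℚ - t) P Q ≡ lerp t Q P
    lerp-flip (x , y) (x′ , y′) t = cong₂ _,_ (eq t x x′) (eq t y y′)

  -- `path-side` transports only the negative sign, so the path is run from the primed point lying
  -- between the ends of the offending chord: from i′ when y ≤ i, and backwards from j′ when j < y.
  -- The other primed point has positive sign.
  sameRegion⇒unseparated : ∀ {π i j} → SameRegion π (primed i) (primed j) →
      Unseparated (SameBlock π) i j
  sameRegion⇒unseparated path same i<x x≤j =
    ℕ.≰⇒> (λ y≤i → <-asym
      (path-side (sameBlock-sym same) (ℕ.≤-<-trans y≤i i<x) path
        (L-between (x≤i⇒x<i′ y≤i) (i<x⇒i′<x i<x)))
      (L-above (x≤i⇒x<i′ (ℕ.≤-trans y≤i (ℕ.<⇒≤ (ℕ.<-≤-trans i<x x≤j)))) (x≤i⇒x<i′ x≤j))) ,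
    ℕ.≮⇒≥ (λ j<y → <-asym
      (path-side same (ℕ.≤-<-trans x≤j j<y) (sameRegion-sym path)
        (L-between (x≤i⇒x<i′ x≤j) (i<x⇒i′<x j<y)))
      (L-below (i<x⇒i′<x i<x) (i<x⇒i′<x (ℕ.<-trans (ℕ.<-≤-trans i<x x≤j) j<y))))

  sameRegion⇔unseparated : ∀ {π i j} → i ℕ.≤ j →
      SameRegion π (primed i) (primed j) ⇔ Unseparated (SameBlock π) i j
  sameRegion⇔unseparated i≤j = mk⇔ sameRegion⇒unseparated λ uns → unseparated⇒segment i≤j uns ◅ ε

open Geometry using (sameRegion⇔unseparated; sameRegion-sym)

-- Minima, maxima and labels of lists of blocks.

open import Data.Nat.Base hiding (ℕ; suc)
open import Data.Nat.Properties

-- foldr₁ is defined through a local function that carries its initial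
-- arguments along; the underscore is that function, which cannot be named.
module _ {A : Set} (f : A → A → A) where
  foldr₁-∷ : ∀ x y ys → foldr₁ f (x ∷ y ∷ ys) ≡ f x (foldr₁ f (y ∷ ys))
  foldr′-irrelevant : ∀ x (xs : List A) y ys → _ ≡ foldr₁ f (y ∷ ys)
  foldr₁-∷ x y ys with y ∷ ys
  ... | zs = cong (f x) (foldr′-irrelevant x zs y ys)
  foldr′-irrelevant x xs y [] = refl
  foldr′-irrelevant x xs y (z ∷ zs) =
    cong (f y) (trans (foldr′-irrelevant x xs z zs) (sym (foldr′-irrelevant y (z ∷ zs) z zs)))

foldr₁-∈ : ∀ (f : ℕ → ℕ → ℕ) → (∀ x y → f x y ≡ x ⊎ f x y ≡ y) → ∀ B → foldr₁ f B ∈ toList B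
foldr₁-∈ f sel (x ∷ xs) = go x xs
  where
  go : ∀ x xs → foldr₁ f (x ∷ xs) ∈ x ∷ xs
  go x []       = here refl
  go x (y ∷ ys) = subst (_∈ x ∷ y ∷ ys) (sym (foldr₁-∷ f x y ys))
    ([ here , (λ e → there (subst (_∈ y ∷ ys) (sym e) (go y ys))) ]′ (sel x (foldr₁ f (y ∷ ys))))

min-∈ : ∀ B → min B ∈ toList B
min-∈ = foldr₁-∈ _⊓_ ⊓-sel

max-∈ : ∀ B → max B ∈ toList B
max-∈ = foldr₁-∈ _⊔_ ⊔-sel

min-≤ : ∀ B {x} → x ∈ toList B → min B ≤ x
min-≤ (x ∷ []) (here refl) = ≤-refl
min-≤ (x ∷ y ∷ ys) x∈ rewrite foldr₁-∷ _⊓_ x y ys with x∈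
... | here refl = m⊓n≤m x (min (y ∷ ys))
... | there x∈′ = ≤-trans (m⊓n≤n x (min (y ∷ ys))) (min-≤ (y ∷ ys) x∈′)

≤-max : ∀ B {x} → x ∈ toList B → x ≤ max B
≤-max (x ∷ []) (here refl) = ≤-refl
≤-max (x ∷ y ∷ ys) x∈ rewrite foldr₁-∷ _⊔_ x y ys with x∈
... | here refl = m≤m⊔n x (max (y ∷ ys))
... | there x∈′ = ≤-trans (≤-max (y ∷ ys) x∈′) (m≤n⊔m x (max (y ∷ ys)))

word-++ : ∀ π σ → word (π ++ σ) ≡ word π ++ word σ
word-++ π σ =
    trans (cong concat (map-++ toList π σ)) (sym (concat-++ (map toList π) (map toList σ)))

∈-word : ∀ {π B x} → B ∈ π → x ∈ toList B → x ∈ word π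
∈-word {B ∷ π} (here refl) x∈B = ∈-++⁺ˡ x∈B
∈-word {C ∷ π} (there B∈π) x∈B = ∈-++⁺ʳ (toList C) (∈-word B∈π x∈B)

word-↭ : ∀ {π σ} → π ↭ σ → word π ↭ word σ
word-↭ Perm.refl = ↭-refl
word-↭ (Perm.prep B p) = Perm.++⁺ˡ (toList B) (word-↭ p)
word-↭ (Perm.swap {π} {σ} B C p) =
    ↭-trans (Perm.shifts (toList B) (toList C))
      (Perm.++⁺ˡ (toList C) (Perm.++⁺ˡ (toList B) (word-↭ p)))
word-↭ (Perm.trans p q) = ↭-trans (word-↭ p) (word-↭ q)

sameBlock⇒∈ : ∀ {π x y} → SameBlock π x y → x ∈ word π × y ∈ word π
sameBlock⇒∈ s with find s
... | B , B∈π , x∈B , y∈B = ∈-word B∈π x∈B , ∈-word B∈π y∈B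

-- Disjoint blocks, non-crossing and canonical partitions.

Unique-disjoint : ∀ xs {ys : List ℕ} → Unique (xs ++ ys) → Disjoint xs ys
Unique-disjoint (x ∷ xs) (x≢ ∷ u) (here refl , x∈ys) = All.lookup x≢ (∈-++⁺ʳ xs x∈ys) refl
Unique-disjoint (x ∷ xs) (x≢ ∷ u) (there z∈xs , z∈ys) = Unique-disjoint xs u (z∈xs , z∈ys)

Unique-++ʳ : ∀ xs {ys : List ℕ} → Unique (xs ++ ys) → Unique ys
Unique-++ʳ [] u = u
Unique-++ʳ (x ∷ xs) (_ ∷ u) = Unique-++ʳ xs u

Unique-++ˡ : ∀ xs {ys : List ℕ} → Unique (xs ++ ys) → Unique xs
Unique-++ˡ [] u = []
Unique-++ˡ (x ∷ xs) (x≢ ∷ u) = All.++⁻ˡ xs x≢ ∷ Unique-++ˡ xs u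

lookup-unique : ∀ π {x} → Unique (word π) → (i j : Fin (length π)) →
  x ∈ toList (lookup π i) → x ∈ toList (lookup π j) → i ≡ j
lookup-unique (B ∷ π) u Fin.zero    Fin.zero    _ _ = refl
lookup-unique (B ∷ π) u Fin.zero    (Fin.suc j) p q =
    ⊥-elim (Unique-disjoint (toList B) u (p , ∈-word (∈-lookup {xs = π} j) q))
lookup-unique (B ∷ π) u (Fin.suc i) Fin.zero    p q =
    ⊥-elim (Unique-disjoint (toList B) u (q , ∈-word (∈-lookup {xs = π} i) p))
lookup-unique (B ∷ π) u (Fin.suc i) (Fin.suc j) p q =
    cong Fin.suc (lookup-unique π (Unique-++ʳ (toList B) u) i j p q)

-- Phrased with a relation on labels instead of positions of blocks, the condition is insensitive to
-- sorting and reversing the list; for disjoint blocks it yields `NonCrossing`.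
NonCrossingPairs : (ℕ → ℕ → Set) → Set
NonCrossingPairs R = ∀ {a b c d} → a < b → b < c → c < d → R a c → R b d → R a b

nonCrossingPairs⇒nonCrossing : ∀ {π} → Unique (word π) → NonCrossingPairs (SameBlock π) →
    NonCrossing π
nonCrossingPairs⇒nonCrossing {π} u nc i j i≢j {a} {b} a<b b<c c<d ((a∈ , c∈) , (b∈ , d∈)) =
  i≢j (trans (lookup-unique π u i k a∈ a∈k) (lookup-unique π u k j b∈k b∈))
  where
  ab : SameBlock π a b
  ab = nc a<b b<c c<d (lose (∈-lookup {xs = π} i) (a∈ , c∈))
      (lose (∈-lookup {xs = π} j) (b∈ , d∈))
  k = Any.index ab
  a∈k = proj₁ (Any.lookup-index ab)
  b∈k = proj₂ (Any.lookup-index ab)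

-- Equal minima would be a label common to two blocks, so the weak order that sorting delivers is
-- strict.
strict-canonical : ∀ {π} → Unique (word π) → Linked (λ B C → min B ≥ min C) π → Canonical π
strict-canonical u [] = []
strict-canonical u [-] = [-]
strict-canonical {B ∷ C ∷ π} u (B≥C ∷ l) =
  ≤∧≢⇒< B≥C (λ C≡B →
      Unique-disjoint (toList B) u (min-∈ B , ∈-++⁺ˡ (subst (_∈ toList C) C≡B (min-∈ C))))
  ∷ strict-canonical (Unique-++ʳ (toList B) u) l

[n]-unique : ∀ n → Unique [ n ]₁
[n]-unique n = Unique.applyUpTo⁺₁ suc n (λ i<j _ e → <⇒≢ i<j (suc-injective e))

Unique-resp-↭ : ∀ {xs ys : List ℕ} → xs ↭ ys → Unique xs → Unique ys
Unique-resp-↭ p = PermS.Unique-resp-↭ (setoid ℕ) (↭⇒↭ₛ p)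

isNCP : ∀ {n π} → word π ↭ [ n ]₁ → All (λ B → Linked _<_ (toList B)) π →
  Linked (λ B C → min B ≥ min C) π → NonCrossingPairs (SameBlock π) → IsNCP n π
isNCP {n} {π} p inc l nc = record
  { isNCCP = record
    { partition = p
    ; increasing = inc
    ; descents = Linked.map (λ {B} {C} C<B → <-≤-trans C<B (≤-max B (min-∈ B))) can
    }
  ; nonCrossing = nonCrossingPairs⇒nonCrossing u nc
  ; canonical = can
  }
  where
  u = Unique-resp-↭ (↭-sym p) ([n]-unique n)
  can = strict-canonical u l

-- Trees of words that avoid 312, their chains and their dual blocks.

data Ordered : Tree → Set where
  leaf : Ordered leaf
  node : ∀ {l a r} → (∀ {x} → x ∈ φ l → a < x) → (∀ {x} → x ∈ φ r → a < x) →
    (∀ {x y} → x ∈ φ l → y ∈ φ r → x < y) → Ordered l → Ordered r → Ordered (node l a r)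

-- A left label x above a right label y would give the pattern x, a, y, because the root a is read
-- between them and is smaller than both.
avoids312⇒ordered : ∀ {t} → Increasing t → Unique (φ t) → Avoids312 (φ t) → Ordered t
avoids312⇒ordered leaf _ _ = leaf
avoids312⇒ordered {node l a r} (node a⊏l a⊏r il ir) u av = node
  (All.lookup (⊏-labels a⊏l il)) (All.lookup (⊏-labels a⊏r ir)) l<r
  (avoids312⇒ordered il (Unique-++ˡ (φ l) u) (λ s → av (Sublist.++⁺ʳ (a ∷ φ r) s)))
  (avoids312⇒ordered ir (Unique-++ʳ (a ∷ []) (Unique-++ʳ (φ l) u))
      (λ s → av (Sublist.++⁺ˡ (φ l) (a Sublist.∷ʳ s))))
  where
  l<r : ∀ {x y} → x ∈ φ l → y ∈ φ r → x < y
  l<r {x} {y} x∈l y∈r with <-cmp x y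
  ... | tri< x<y _ _ = x<y
  ... | tri≈ _ refl _ = ⊥-elim (Unique-disjoint (φ l) u (x∈l , there y∈r))
  ... | tri> _ _ y<x =
      ⊥-elim (av (Sublist.++⁺ (Sublist.from∈ x∈l) (refl Sublist.∷ Sublist.from∈ y∈r))
    (All.lookup (⊏-labels a⊏r ir) y∈r , y<x))

-- For an ordered t, dual t lists the blocks peeled off φ t by increasing minimum.
-- Its block containing the last label of φ t is records t, which becomes part of
-- the block of p if t is the left subtree of p; inner t lists the other blocks, and
-- residue t is what remains of φ t after deleting records t.
records : Tree → List ℕ
records leaf = []
records (node l a leaf) = a ∷ records l
records (node l a r@(node _ _ _)) = records r

inner : Tree → List Block
inner leaf = []
inner (node l a leaf) = inner l
inner (node l a r@(node _ _ _)) = ((a ∷ records l) ∷ inner l) ++ inner r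

attach : ℕ → Tree → List Block
attach p t = (p ∷ records t) ∷ inner t

dual : Tree → List Block
dual leaf = []
dual (node l a r) = attach a l ++ dual r

residue : Tree → List ℕ
residue leaf = []
residue (node l a leaf) = residue l
residue (node l a r@(node _ _ _)) = φ l ++ a ∷ residue r

spine-below-↭ : ∀ t → spine t ++ word (below t) ↭ φ t
chains-word : ∀ t → word (chains t) ≡ spine t ++ word (below t)
chains-word leaf = refl
chains-word (node l a r) = refl
spine-below-↭ leaf = ↭-refl
spine-below-↭ (node l a r) = begin
  a ∷ spine r ++ word (chains l ++ below r)
      ≡⟨ cong (λ w → a ∷ spine r ++ w) (word-++ (chains l) (below r)) ⟩
  a ∷ spine r ++ word (chains l) ++ word (below r)
      ↭⟨ ↭-prep a (Perm.shifts (spine r) (word (chains l))) ⟩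
  a ∷ word (chains l) ++ spine r ++ word (below r)
      ≡⟨ cong (λ w → a ∷ w ++ spine r ++ word (below r)) (chains-word l) ⟩
  a ∷ (spine l ++ word (below l)) ++ spine r ++ word (below r)
      ↭⟨ ↭-prep a (Perm.++⁺ (spine-below-↭ l) (spine-below-↭ r)) ⟩
  a ∷ φ l ++ φ r ↭⟨ Perm.shift a (φ l) (φ r) ⟨
  φ l ++ a ∷ φ r ∎
  where open PermutationReasoning

chains-↭ : ∀ t → word (chains t) ↭ φ t
chains-↭ t = ↭-trans (↭-reflexive (chains-word t)) (spine-below-↭ t)

inner-↭ : ∀ t → records t ++ word (inner t) ↭ φ t
inner-↭ leaf = ↭-refl
inner-↭ (node l a leaf) = ↭-trans (↭-prep a (inner-↭ l)) (Perm.∷↭∷ʳ a (φ l))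
inner-↭ (node l a r@(node _ _ _)) = begin
  records r ++ (a ∷ records l) ++ word (inner l ++ inner r)
      ≡⟨ cong (λ w → records r ++ (a ∷ records l) ++ w) (word-++ (inner l) (inner r)) ⟩
  records r ++ a ∷ records l ++ word (inner l) ++ word (inner r)
      ≡⟨ cong (λ w → records r ++ a ∷ w)
        (++-assoc (records l) (word (inner l)) (word (inner r))) ⟨
  records r ++ (a ∷ records l ++ word (inner l)) ++ word (inner r)
      ↭⟨ Perm.shifts (records r) (a ∷ records l ++ word (inner l)) ⟩
  (a ∷ records l ++ word (inner l)) ++ records r ++ word (inner r)
      ↭⟨ Perm.++⁺ (↭-prep a (inner-↭ l)) (inner-↭ r) ⟩
  a ∷ φ l ++ φ r ↭⟨ Perm.shift a (φ l) (φ r) ⟨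
  φ l ++ a ∷ φ r ∎
  where open PermutationReasoning

dual-↭ : ∀ t → word (dual t) ↭ φ t
dual-↭ leaf = ↭-refl
dual-↭ (node l a r) = begin
  word (attach a l ++ dual r) ≡⟨ word-++ (attach a l) (dual r) ⟩
  word (attach a l) ++ word (dual r) ↭⟨ Perm.++⁺ (↭-prep a (inner-↭ l)) (dual-↭ r) ⟩
  a ∷ φ l ++ φ r ↭⟨ Perm.shift a (φ l) (φ r) ⟨
  φ l ++ a ∷ φ r ∎
  where open PermutationReasoning

spine⊆ : ∀ t {x} → x ∈ spine t → x ∈ φ t
spine⊆ t x∈ = Perm.∈-resp-↭ (spine-below-↭ t) (∈-++⁺ˡ x∈)

below⊆ : ∀ t {x} → x ∈ word (below t) → x ∈ φ t
below⊆ t x∈ = Perm.∈-resp-↭ (spine-below-↭ t) (∈-++⁺ʳ (spine t) x∈)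

records⊆ : ∀ t {x} → x ∈ records t → x ∈ φ t
records⊆ t x∈ = Perm.∈-resp-↭ (inner-↭ t) (∈-++⁺ˡ x∈)

inner⊆ : ∀ t {x} → x ∈ word (inner t) → x ∈ φ t
inner⊆ t x∈ = Perm.∈-resp-↭ (inner-↭ t) (∈-++⁺ʳ (records t) x∈)

attach⊆ : ∀ {p} t {x} → x ∈ word (attach p t) → x ∈ p ∷ φ t
attach⊆ {p} t x∈ = Perm.∈-resp-↭ (↭-prep p (inner-↭ t)) x∈

same-chains⊆ : ∀ t {x y} → SameBlock (chains t) x y → x ∈ φ t × y ∈ φ t
same-chains⊆ t s =
  let x∈ , y∈ = sameBlock⇒∈ s
  in Perm.∈-resp-↭ (chains-↭ t) x∈ , Perm.∈-resp-↭ (chains-↭ t) y∈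

same-attach⊆ : ∀ {p} t {x y} → SameBlock (attach p t) x y → x ∈ p ∷ φ t × y ∈ p ∷ φ t
same-attach⊆ t s = let x∈ , y∈ = sameBlock⇒∈ s in attach⊆ t x∈ , attach⊆ t y∈

-- Pairs of labels in a common chain.

data ChainPair (l : Tree) (a : ℕ) (r : Tree) (x y : ℕ) : Set where
  left   : SameBlock (chains l) x y → ChainPair l a r x y
  right  : SameBlock (chains r) x y → ChainPair l a r x y
  root   : x ∈ a ∷ [] → y ∈ a ∷ spine r → ChainPair l a r x y
  toRoot : x ∈ spine r → y ∈ a ∷ [] → ChainPair l a r x y

same-spine : ∀ r {x y} → x ∈ spine r → y ∈ spine r → SameBlock (chains r) x y
same-spine (node l a r) x∈ y∈ = here (x∈ , y∈)

same-below : ∀ r {x y} → SameBlock (below r) x y → SameBlock (chains r) x y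
same-below (node l a r) s = there s

-- The root only prolongs the first chain of r. Pairs inside `spine r` are classed under `right`,
-- where the induction hypothesis covers them.
chainPair : ∀ l a r {x y} → SameBlock (chains (node l a r)) x y → ChainPair l a r x y
chainPair l a r (here (here e , y∈)) = root (here e) y∈
chainPair l a r (here (there x∈ , here e)) = toRoot x∈ (here e)
chainPair l a r (here (there x∈ , there y∈)) = right (same-spine r x∈ y∈)
chainPair l a r (there s) with Any.++⁻ (chains l) s
... | inj₁ s = left s
... | inj₂ s = right (same-below r s)

left-chains : ∀ l a r {x y} → SameBlock (chains l) x y → SameBlock (chains (node l a r)) x y
left-chains l a r s = there (Any.++⁺ˡ s)

right-chains : ∀ l a r {x y} → SameBlock (chains r) x y → SameBlock (chains (node l a r)) x y
right-chains l a (node _ _ _) (here (x∈ , y∈)) = here (there x∈ , there y∈)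
right-chains l a (node _ _ _) (there s) = there (Any.++⁺ʳ (chains l) s)

root-≤ : ∀ {l a r x} → Ordered (node l a r) → x ∈ φ (node l a r) → a ≤ x
root-≤ {l} (node a<l a<r _ _ _) x∈ with ∈-++⁻ (φ l) x∈
... | inj₁ x∈l = <⇒≤ (a<l x∈l)
... | inj₂ (here refl) = ≤-refl
... | inj₂ (there x∈r) = <⇒≤ (a<r x∈r)

root-<ˡ : ∀ {l a r x} → Ordered (node l a r) → x ∈ φ l → a < x
root-<ˡ (node a<l _ _ _ _) = a<l

root-<ʳ : ∀ {l a r x} → Ordered (node l a r) → x ∈ φ r → a < x
root-<ʳ (node _ a<r _ _ _) = a<r

∈-left : ∀ l r {a x} → x ∈ φ l → x ∈ φ (node l a r)
∈-left l r = ∈-++⁺ˡ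

∈-root : ∀ l r {a} → a ∈ φ (node l a r)
∈-root l r = ∈-++⁺ʳ (φ l) (here refl)

∈-right : ∀ l r {a x} → x ∈ φ r → x ∈ φ (node l a r)
∈-right l r = ∈-++⁺ʳ (φ l) ∘ there

-- Labels on the left are below those on the right, so a pair from l cannot interlace with one from
-- r. Only the chain of the root needs an argument, and there the root, being the minimum, must be
-- the first of the four labels.
chains-nonCrossing : ∀ {t} → Ordered t → NonCrossingPairs (SameBlock (chains t))
chains-nonCrossing {node l e r} o@(node e<l e<r l<r ol or) {a} {b} {c} {d} a<b b<c c<d ac bd
  with chainPair l e r ac | chainPair l e r bd
... | toRoot a∈ (here refl) | _ = ⊥-elim (<-asym (<-trans a<b b<c) (e<r (spine⊆ r a∈)))
... | _ | toRoot b∈ (here refl) = ⊥-elim (<-asym (<-trans b<c c<d) (e<r (spine⊆ r b∈)))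
... | _ | root (here refl) _ = ⊥-elim (<⇒≱ a<b (root-≤ o (proj₁ (same-chains⊆ (node l e r) ac))))
... | left ac | left bd = left-chains l e r (chains-nonCrossing ol a<b b<c c<d ac bd)
... | right ac | right bd = right-chains l e r (chains-nonCrossing or a<b b<c c<d ac bd)
... | left ac | right bd =
    ⊥-elim (<-asym b<c (l<r (proj₂ (same-chains⊆ l ac)) (proj₁ (same-chains⊆ r bd))))
... | right ac | left bd =
    ⊥-elim (<-asym a<b (l<r (proj₁ (same-chains⊆ l bd)) (proj₁ (same-chains⊆ r ac))))
... | root (here refl) (here refl) | _ = ⊥-elim (<-asym a<b b<c)
... | root (here refl) (there c∈) | left bd =
    ⊥-elim (<-asym c<d (l<r (proj₂ (same-chains⊆ l bd)) (spine⊆ r c∈)))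
chains-nonCrossing {node l e r@(node rl m rr)} (node _ _ _ _ or) {a} {b} {c} {d} a<b b<c c<d ac bd
  | root (here refl) (there c∈) | right bd′ =
      -- m and c cross b and d within r unless b is on the spine already.
      here (here refl , there (b∈spine (m≤n⇒m<n∨m≡n (root-≤ or (proj₁ (same-chains⊆ r bd′))))))
  where
  b∈spine : m < b ⊎ m ≡ b → b ∈ spine r
  b∈spine (inj₂ m≡b) = here (sym m≡b)
  b∈spine (inj₁ m<b) with chains-nonCrossing or m<b b<c c<d (same-spine r (here refl) c∈) bd′
  ... | here (_ , b∈) = b∈
  ... | there s with Any.++⁻ (chains rl) s
  ...   | inj₁ s = ⊥-elim (<-irrefl refl (root-<ˡ or (proj₁ (same-chains⊆ rl s))))
  ...   | inj₂ s = ⊥-elim (<-irrefl refl (root-<ʳ or (below⊆ rr (proj₁ (sameBlock⇒∈ s)))))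

-- Dual blocks and intervals that split no chain.

attach-left : ∀ {p} l a r {x y} → SameBlock (attach a l) x y →
    SameBlock (attach p (node l a r)) x y
attach-left l a leaf (here (x∈ , y∈)) = here (there x∈ , there y∈)
attach-left l a leaf (there s) = there s
attach-left l a (node _ _ _) s = there (Any.++⁺ˡ s)

attach-right : ∀ {p} l a r {x y} → r ≢ leaf → SameBlock (attach p r) x y →
    SameBlock (attach p (node l a r)) x y
attach-right l a leaf r≢leaf s = ⊥-elim (r≢leaf refl)
attach-right l a (node _ _ _) _ (here s) = here s
attach-right l a (node _ _ _) _ (there s) = there (Any.++⁺ʳ (attach a l) s)

unseparated-chainPair : ∀ {l a r i j} → Unseparated (ChainPair l a r) i j →
  Unseparated (SameBlock (chains (node l a r))) i j
unseparated-chainPair {l} {a} {r} u s = u (chainPair l a r s)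

-- Without a right subtree, the block of p is the block of a in `attach a l` with p prefixed, and
-- the induction goes to l with a as pending parent. With one, every block comes from `attach a l`
-- or from `attach p r`, so p is handed on to r.
attach⇒unseparated : ∀ {t p i j} → Ordered t → (∀ {x} → x ∈ φ t → p < x) → i ≤ j →
  SameBlock (attach p t) i j → Unseparated (SameBlock (chains t)) i j
attach⇒unseparated leaf _ _ _ ()
attach⇒unseparated {node l a leaf} {p} {i} {j} (node a<l a<r l<r ol or) p<t i≤j s =
    unseparated-chainPair (h s)
  where
  inL : SameBlock (attach a l) i j → Unseparated (ChainPair l a leaf) i j
  inL s (left xy) = attach⇒unseparated ol a<l i≤j s xy
  inL s (root (here refl) (here refl)) = _,_
  h : SameBlock (attach p (node l a leaf)) i j → Unseparated (ChainPair l a leaf) i j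
  h (there s) = inL (there s)
  h (here (there i∈ , there j∈)) = inL (here (i∈ , j∈))
  h (here (there i∈ , here refl)) = ⊥-elim (≤⇒≯ i≤j (p<t (records⊆ (node l a leaf) i∈)))
  h (here (here refl , here refl)) _ i<x x≤j = ⊥-elim (<⇒≱ i<x x≤j)
  h (here (here refl , there j∈)) (root (here refl) (here refl)) i<x x≤j = i<x , x≤j
  h (here (here refl , there j∈)) (left xy) i<x x≤j =
    let x∈l , y∈l = same-chains⊆ l xy
        a≤j = <⇒≤ (<-≤-trans (a<l x∈l) x≤j)
        _ , y≤j = attach⇒unseparated ol a<l a≤j (here (here refl , j∈)) xy (a<l x∈l) x≤j
    in p<t (∈-left l leaf y∈l) , y≤j
attach⇒unseparated {node l a r@(node rl m rr)} {p} {i} {j} (node a<l a<r l<r ol or) p<t i≤j s =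
  unseparated-chainPair ([ inL , inR ]′ (split s))
  where
  split : SameBlock (attach p (node l a r)) i j →
      SameBlock (attach a l) i j ⊎ SameBlock (attach p r) i j
  split (here ij) = inj₂ (here ij)
  split (there s) = Sum.map id there (Any.++⁻ (attach a l) s)
  p<r : ∀ {x} → x ∈ φ r → p < x
  p<r = p<t ∘ ∈-right l r
  inL : SameBlock (attach a l) i j → Unseparated (ChainPair l a r) i j
  inL s = go (proj₁ (same-attach⊆ l s)) (proj₂ (same-attach⊆ l s))
    where
    ¬r : ∀ {x} → j ∈ a ∷ φ l → x ∈ φ r → ¬ x ≤ j
    ¬r (here refl) x∈r = <⇒≱ (a<r x∈r)
    ¬r (there j∈l) x∈r = <⇒≱ (l<r j∈l x∈r)
    a≤i : i ∈ a ∷ φ l → a ≤ i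
    a≤i (here refl) = ≤-refl
    a≤i (there i∈l) = <⇒≤ (a<l i∈l)
    go : i ∈ a ∷ φ l → j ∈ a ∷ φ l → Unseparated (ChainPair l a r) i j
    go _ _ (left xy) = attach⇒unseparated ol a<l i≤j s xy
    go _ j∈ (right xy) _ x≤j = ⊥-elim (¬r j∈ (proj₁ (same-chains⊆ r xy)) x≤j)
    go i∈ _ (root (here refl) _) i<a _ = ⊥-elim (<⇒≱ i<a (a≤i i∈))
    go _ j∈ (toRoot x∈ _) _ x≤j = ⊥-elim (¬r j∈ (spine⊆ r x∈) x≤j)
  inR : SameBlock (attach p r) i j → Unseparated (ChainPair l a r) i j
  inR s = go (proj₁ (same-attach⊆ r s)) (proj₂ (same-attach⊆ r s))
    where
    ih : Unseparated (SameBlock (chains r)) i j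
    ih = attach⇒unseparated or p<r i≤j s
    go : i ∈ p ∷ φ r → j ∈ p ∷ φ r → Unseparated (ChainPair l a r) i j
    go _ _ (right xy) = ih xy
    go i∈ (here refl) c i<x x≤j = ⊥-elim (<-irrefl refl (<-≤-trans i<x (≤-trans x≤j (p≤i i∈))))
      where
      p≤i : i ∈ p ∷ φ r → p ≤ i
      p≤i (here refl) = ≤-refl
      p≤i (there i∈r) = <⇒≤ (p<r i∈r)
    go (here refl) (there j∈r) (left xy) _ _ =
      let y∈l = proj₂ (same-chains⊆ l xy) in p<t (∈-left l r y∈l) , <⇒≤ (l<r y∈l j∈r)
    go (there i∈r) (there j∈r) (left xy) i<x _ =
        ⊥-elim (<-asym i<x (l<r (proj₁ (same-chains⊆ l xy)) i∈r))
    go (here refl) (there j∈r) (root (here refl) (here refl)) i<x x≤j = i<x , x≤j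
    -- The root m of r lies in (p , j] too, and by induction it brings along the rest of its chain.
    go (here refl) (there j∈r) (root (here refl) (there y∈)) i<x x≤j =
      ih (same-spine r (here refl) y∈) (p<r (∈-root rl rr)) (root-≤ or j∈r)
    go (there i∈r) (there j∈r) (root (here refl) _) i<x _ = ⊥-elim (<-asym i<x (a<r i∈r))
    go (here refl) (there j∈r) (toRoot x∈ (here refl)) i<x _ = p<t (∈-root l r) , <⇒≤ (a<r j∈r)
    -- A spine label in (i , j] would draw the root of r into the interval, yet that root is at most
    -- i.
    go (there i∈r) (there j∈r) (toRoot x∈ (here refl)) i<x x≤j =
      ⊥-elim (<⇒≱ (proj₁ (ih (same-spine r x∈ (here refl)) i<x x≤j)) (root-≤ or i∈r))

unseparated⇒attach : ∀ {t p i j} → Ordered t → (∀ {x} → x ∈ φ t → p < x) → i ≤ j →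
  i ∈ p ∷ φ t → j ∈ p ∷ φ t → Unseparated (SameBlock (chains t)) i j → SameBlock (attach p t) i j
unseparated⇒attach {t} o p<t i≤j (here refl) (here refl) _ = here (here refl , here refl)
unseparated⇒attach {t} o p<t i≤j (there i∈t) (here refl) _ = ⊥-elim (≤⇒≯ i≤j (p<t i∈t))
unseparated⇒attach {node l a leaf} {p} {_} {j} (node a<l a<r l<r ol or) p<t i≤j (here refl)
    (there j∈t) uns = h (unseparated⇒attach ol a<l a≤j (here refl) j∈l uns′)
  where
  a∷l : ∀ {x} → x ∈ φ l ++ a ∷ [] → x ∈ a ∷ φ l
  a∷l x∈ = Perm.∈-resp-↭ (↭-sym (Perm.∷↭∷ʳ a (φ l))) x∈
  j∈l : j ∈ a ∷ φ l
  j∈l = a∷l j∈t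
  a≤j : a ≤ j
  a≤j with j∈l
  ... | here refl = ≤-refl
  ... | there j∈l = <⇒≤ (a<l j∈l)
  -- Labels of l exceed a anyway; the upper bound comes from the larger interval (p , j].
  uns′ : Unseparated (SameBlock (chains l)) a j
  uns′ xy a<x x≤j = a<l (proj₂ (same-chains⊆ l xy)) ,
    proj₂ (uns (left-chains l a leaf xy) (p<t (∈-left l leaf (proj₁ (same-chains⊆ l xy)))) x≤j)
  h : SameBlock (attach a l) a j → SameBlock (attach p (node l a leaf)) p j
  h (here (_ , j∈)) = here (here refl , there j∈)
  h (there s) = ⊥-elim (<-irrefl refl (a<l (inner⊆ l (proj₁ (sameBlock⇒∈ s)))))
unseparated⇒attach {node l a r@(node rl m rr)} {p} {_} {j} o@(node a<l a<r l<r ol or) p<t i≤j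
    (here refl) (there j∈t) uns =
  attach-right l a r (λ ())
      (unseparated⇒attach or (p<t ∘ ∈-right l r) i≤j (here refl) (there j∈r)
        (uns ∘ right-chains l a r))
  where
  -- The labels a and m share a chain and a lies in (p , j], so m lies there as well; this forces j
  -- into r.
  m≤j : m ≤ j
  m≤j = proj₂ (uns (here (here refl , there (here refl))) (p<t (∈-root l r)) (root-≤ o j∈t))
  j∈r : j ∈ φ r
  j∈r with ∈-++⁻ (φ l) j∈t
  ... | inj₁ j∈l = ⊥-elim (<⇒≱ (l<r j∈l (∈-root rl rr)) m≤j)
  ... | inj₂ (here refl) = ⊥-elim (<⇒≱ (a<r (∈-root rl rr)) m≤j)
  ... | inj₂ (there j∈r) = j∈r
unseparated⇒attach {node l a r} {p} {i} {j} (node a<l a<r l<r ol or) p<t i≤j (there i∈t)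
    (there j∈t) uns =
  go (side i∈t) (side j∈t)
  where
  side : ∀ {x} → x ∈ φ (node l a r) → x ∈ a ∷ φ l ⊎ x ∈ φ r
  side x∈ with ∈-++⁻ (φ l) x∈
  ... | inj₁ x∈l = inj₁ (there x∈l)
  ... | inj₂ (here refl) = inj₁ (here refl)
  ... | inj₂ (there x∈r) = inj₂ x∈r
  a≤ : ∀ {x} → x ∈ a ∷ φ l → a ≤ x
  a≤ (here refl) = ≤-refl
  a≤ (there x∈l) = <⇒≤ (a<l x∈l)
  <r : ∀ {x y} → x ∈ a ∷ φ l → y ∈ φ r → x < y
  <r (here refl) y∈r = a<r y∈r
  <r (there x∈l) y∈r = l<r x∈l y∈r
  -- The interval would contain the root m of r but not a, which is at most i, and so split their
  -- common chain.
  crossing : ∀ r → Ordered r → (∀ {x y} → x ∈ a ∷ φ l → y ∈ φ r → x < y) → i ∈ a ∷ φ l → j ∈ φ r →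
    ¬ Unseparated (SameBlock (chains (node l a r))) i j
  crossing (node rl m rr) or <r i∈ j∈r uns =
    <⇒≱ (proj₁ (uns (here (there (here refl) , here refl)) (<r i∈ (∈-root rl rr))
        (root-≤ or j∈r))) (a≤ i∈)
  nonleaf : ∀ {r} → j ∈ φ r → r ≢ leaf
  nonleaf {leaf} () _
  nonleaf {node _ _ _} _ ()
  go : i ∈ a ∷ φ l ⊎ i ∈ φ r → j ∈ a ∷ φ l ⊎ j ∈ φ r → SameBlock (attach p (node l a r)) i j
  go (inj₁ i∈) (inj₁ j∈) =
      attach-left l a r (unseparated⇒attach ol a<l i≤j i∈ j∈ (uns ∘ left-chains l a r))
  go (inj₁ i∈) (inj₂ j∈) = ⊥-elim (crossing r or <r i∈ j∈ uns)
  go (inj₂ i∈) (inj₁ j∈) = ⊥-elim (≤⇒≯ i≤j (<r j∈ i∈))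
  go (inj₂ i∈) (inj₂ j∈) = attach-right l a r (nonleaf j∈)
    (unseparated⇒attach or (p<t ∘ ∈-right l r) i≤j (there i∈) (there j∈)
        (uns ∘ right-chains l a r))

-- For a nonempty t, `attach p t` differs from `dual t` only in that p joins the block of the last
-- node on the right spine and that block moves to the front.
attach⇒dual : ∀ t {p i j} → (∀ {x} → x ∈ φ t → p < x) → p < i → p < j →
    SameBlock (attach p t) i j → SameBlock (dual t) i j
attach⇒dual _ _ p<i _ (here (here refl , _)) = ⊥-elim (<-irrefl refl p<i)
attach⇒dual _ _ _ p<j (here (there _ , here refl)) = ⊥-elim (<-irrefl refl p<j)
attach⇒dual (node l a leaf) _ _ _ (here (there i∈ , there j∈)) = here (i∈ , j∈)
attach⇒dual (node l a leaf) _ _ _ (there s) = there (Any.++⁺ˡ s)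
attach⇒dual (node l a r@(node _ _ _)) p<t p<i p<j (here (there i∈ , there j∈)) =
  Any.++⁺ʳ (attach a l) (attach⇒dual r (p<t ∘ ∈-right l r) p<i p<j (here (there i∈ , there j∈)))
attach⇒dual (node l a r@(node _ _ _)) p<t p<i p<j (there s) =
  [ Any.++⁺ˡ
  , (λ s → Any.++⁺ʳ (attach a l) (attach⇒dual r (p<t ∘ ∈-right l r) p<i p<j (there s)))
  ]′ (Any.++⁻ (attach a l) s)

dual⇒attach : ∀ t {p i j} → SameBlock (dual t) i j → SameBlock (attach p t) i j
dual⇒attach (node l a r) s with Any.++⁻ (attach a l) s
... | inj₁ s = attach-left l a r s
dual⇒attach (node l a r@(node _ _ _)) _ | inj₂ s = attach-right l a r (λ ()) (dual⇒attach r s)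

-- This is the case p = 0 of the two inductions; positive labels never meet the virtual parent.
dual⇔unseparated : ∀ {t i j} → Ordered t → (∀ {x} → x ∈ φ t → 0 < x) → i ∈ φ t → j ∈ φ t → i ≤ j →
  SameBlock (dual t) i j ⇔ Unseparated (SameBlock (chains t)) i j
dual⇔unseparated {t} {i} {j} o 0<t i∈ j∈ i≤j = mk⇔ {B = Unseparated (SameBlock (chains t)) i j}
  (λ s → attach⇒unseparated o 0<t i≤j (dual⇒attach t s))
  (λ u → attach⇒dual t 0<t (0<t i∈) (0<t j∈)
      (unseparated⇒attach o 0<t i≤j (there i∈) (there j∈) u))

-- Order within blocks and among their minima.

attach-increasing : ∀ {t p} → Ordered t → (∀ {x} → x ∈ φ t → p < x) → Linked _<_ (p ∷ records t)
attach-increasing leaf _ = [-]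
attach-increasing {node l a leaf} (node a<l _ _ ol _) p<t =
    p<t (∈-root l leaf) ∷ attach-increasing ol a<l
attach-increasing {node l a r@(node _ _ _)} (node _ _ _ _ or) p<t =
    attach-increasing or (p<t ∘ ∈-right l r)

inner-increasing : ∀ {t} → Ordered t → All (λ B → Linked _<_ (toList B)) (inner t)
inner-increasing leaf = []
inner-increasing {node l a leaf} (node _ _ _ ol _) = inner-increasing ol
inner-increasing {node l a r@(node _ _ _)} (node a<l _ _ ol or) =
  attach-increasing ol a<l ∷ All.++⁺ (inner-increasing ol) (inner-increasing or)

dual-increasing : ∀ {t} → Ordered t → All (λ B → Linked _<_ (toList B)) (dual t)
dual-increasing leaf = []
dual-increasing (node a<l _ _ ol or) =
  attach-increasing ol a<l ∷ All.++⁺ (inner-increasing ol) (dual-increasing or)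

spine-increasing : ∀ {t p} → Ordered t → (∀ {x} → x ∈ φ t → p < x) → Linked _<_ (p ∷ spine t)
spine-increasing leaf _ = [-]
spine-increasing {node l a r} (node _ a<r _ _ or) p<t = p<t (∈-root l r) ∷ spine-increasing or a<r

chains-increasing : ∀ {t} → Ordered t → All (λ B → Linked _<_ (toList B)) (chains t)
below-increasing : ∀ {t} → Ordered t → All (λ B → Linked _<_ (toList B)) (below t)
chains-increasing leaf = []
chains-increasing o@(node _ a<r _ _ or) = spine-increasing or a<r ∷ below-increasing o
below-increasing leaf = []
below-increasing (node _ _ _ ol or) = All.++⁺ (chains-increasing ol) (below-increasing or)

infix 4 _≺_
_≺_ : Block → Block → Set
B ≺ C = min B < min C

≺-sorted-++ : ∀ {π σ} → (∀ {x y} → x ∈ word π → y ∈ word σ → x < y) →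
  AllPairs _≺_ π → AllPairs _≺_ σ → AllPairs _≺_ (π ++ σ)
≺-sorted-++ π<σ sπ sσ = AllPairs.++⁺ sπ sσ
  (All.tabulate λ {B} B∈π → All.tabulate λ {C} C∈σ →
      π<σ (∈-word B∈π (min-∈ B)) (∈-word C∈σ (min-∈ C)))

≺-sorted-∷ : ∀ {a as π} → (∀ {x} → x ∈ word π → a < x) → AllPairs _≺_ π →
    AllPairs _≺_ ((a ∷ as) ∷ π)
≺-sorted-∷ {a} {as} a<π sπ =
  (All.tabulate λ {C} C∈π →
      ≤-<-trans (min-≤ (a ∷ as) (here refl)) (a<π (∈-word C∈π (min-∈ C)))) ∷ sπ

∈-word-++⁻ : ∀ π {σ x} → x ∈ word (π ++ σ) → x ∈ word π ⊎ x ∈ word σ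
∈-word-++⁻ π {σ} x∈ = ∈-++⁻ (word π) (subst (_ ∈_) (word-++ π σ) x∈)

module _ {l a r} (a<l : ∀ {x} → x ∈ φ l → a < x) (a<r : ∀ {x} → x ∈ φ r → a < x)
  (l<r : ∀ {x y} → x ∈ φ l → y ∈ φ r → x < y) where
  attach-++-sorted : ∀ {σ} → (∀ {x} → x ∈ word σ → x ∈ φ r) →
    AllPairs _≺_ (inner l) → AllPairs _≺_ σ → AllPairs _≺_ (attach a l ++ σ)
  attach-++-sorted {σ} σ⊆r sl sσ = ≺-sorted-∷
    (λ x∈ → [ a<l ∘ inner⊆ l , a<r ∘ σ⊆r ]′ (∈-word-++⁻ (inner l) x∈))
    (≺-sorted-++ (λ x∈ y∈ → l<r (inner⊆ l x∈) (σ⊆r y∈)) sl sσ)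

inner-sorted : ∀ {t} → Ordered t → AllPairs _≺_ (inner t)
inner-sorted leaf = []
inner-sorted {node l a leaf} (node _ _ _ ol _) = inner-sorted ol
inner-sorted {node l a r@(node _ _ _)} (node a<l a<r l<r ol or) =
  attach-++-sorted {l} {a} {r} a<l a<r l<r (inner⊆ r) (inner-sorted ol) (inner-sorted or)

dual-sorted : ∀ {t} → Ordered t → AllPairs _≺_ (dual t)
dual-sorted leaf = []
dual-sorted {node l a r} (node a<l a<r l<r ol or) =
  attach-++-sorted {l} {a} {r} a<l a<r l<r (Perm.∈-resp-↭ (dual-↭ r)) (inner-sorted ol)
      (dual-sorted or)

module _ {A : Set} {R : A → A → Set} where
  AllPairs-reverse : ∀ {xs} → AllPairs R xs → AllPairs (λ x y → R y x) (reverse xs)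
  AllPairs-reverse [] = []
  AllPairs-reverse {x ∷ xs} (Rx ∷ Rxs) =
    subst (AllPairs (λ x y → R y x)) (sym (unfold-reverse x xs)) (AllPairs.++⁺
      (AllPairs-reverse Rxs) ([] ∷ []) (All.map (_∷ []) (Perm.All-resp-↭ (↭-sym (Perm.↭-reverse xs)) Rx)))

-- Runs, scans and deletions along the tree.

runs-head : ∀ x xs → ∃₂ λ as Bs → runs (x ∷ xs) ≡ (x ∷ as) ∷ Bs
runs-head x xs with runs xs
... | [] = [] , [] , refl
... | B ∷ Bs with x <? head B
...   | yes _ = toList B , Bs , refl
...   | no  _ = [] , B ∷ Bs , refl

runs-word : ∀ xs → word (runs xs) ≡ xs
runs-word [] = refl
runs-word (x ∷ xs) with runs xs | runs-word xs
... | [] | e = cong (x ∷_) e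
... | B ∷ Bs | e with x <? head B
...   | yes _ = cong (x ∷_) e
...   | no  _ = cong (x ∷_) e

runs-∷-< : ∀ {x y ys B Bs} → x < y → runs (y ∷ ys) ≡ B ∷ Bs → runs (x ∷ y ∷ ys) ≡ (x ∷⁺ B) ∷ Bs
runs-∷-< {x} {y} {ys} {B} x<y e with runs (y ∷ ys) | runs-head y ys
runs-∷-< {x} {y} x<y refl | _ | as , Bs , refl with x <? y
... | yes _ = refl
... | no x≮y = ⊥-elim (x≮y x<y)

runs-∷-> : ∀ {x a v} → a < x → runs (x ∷ a ∷ v) ≡ (x ∷ []) ∷ runs (a ∷ v)
runs-∷-> {x} {a} {v} a<x with runs (a ∷ v) | runs-head a v
... | _ | as , Bs , refl with x <? a
...   | yes x<a = ⊥-elim (<-asym x<a a<x)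
...   | no _ = refl

-- Any entry standing right before `a` exceeds it, so a descent cuts the word there.
runs-++ : ∀ xs {a v} → (∀ {x} → x ∈ xs → a < x) → runs (xs ++ a ∷ v) ≡ runs xs ++ runs (a ∷ v)
runs-++ [] _ = refl
runs-++ (x ∷ []) {a} {v} a<xs = runs-∷-> {x} {a} {v} (a<xs (here refl))
runs-++ (x ∷ xs@(y ∷ ys)) {a} {v} a<xs
  with runs (y ∷ ys ++ a ∷ v) | runs (y ∷ ys) | runs-head y ys | runs-++ xs {a} {v} (a<xs ∘ there)
... | _ | _ | as , Bs , refl | refl with x <? y
...   | yes _ = refl
...   | no  _ = refl

-- `scan` looks at a block only through its maximum. This allows a small label to be dropped from
-- the front of a run.
scan-cong : ∀ {m} As Bs → map max As ≡ map max Bs → scan m As ≡ scan m Bs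
scan-cong [] [] _ = refl
scan-cong {m} (A ∷ As) (B ∷ Bs) e with A≡B , As≡Bs ← ∷-injective e | m <? max A | m <? max B
... | yes _   | yes _   =
    cong₂ _∷_ A≡B (trans (cong (λ k → scan k As) A≡B) (scan-cong As Bs As≡Bs))
... | yes m<A | no  m≮B = ⊥-elim (m≮B (subst (m <_) A≡B m<A))
... | no  m≮A | yes m<B = ⊥-elim (m≮A (subst (m <_) (sym A≡B) m<B))
... | no  _   | no  _   = scan-cong As Bs As≡Bs

scan-absorb-≤ : ∀ {m} As {Bs} → All (λ B → max B ≤ m) Bs → scan m (As ++ Bs) ≡ scan m As
scan-absorb-≤ [] [] = refl
scan-absorb-≤ {m} [] {B ∷ Bs} (B≤m ∷ Bs≤m) with m <? max B
... | yes m<B = ⊥-elim (<⇒≱ m<B B≤m)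
... | no _ = scan-absorb-≤ [] Bs≤m
scan-absorb-≤ {m} (A ∷ As) Bs≤m with m <? max A
... | yes m<A = cong (max A ∷_) (scan-absorb-≤ As (All.map (λ B≤m → ≤-trans B≤m (<⇒≤ m<A)) Bs≤m))
... | no _ = scan-absorb-≤ As Bs≤m

-- Once the first block of `As` is scanned, appended or not, the last appended value is at least its
-- maximum and bounds everything in `Bs`.
scan-absorb : ∀ {m} As {Bs} → As ≢ [] → All (λ A → All (λ B → max B ≤ max A) Bs) As →
    scan m (As ++ Bs) ≡ scan m As
scan-absorb [] As≢[] _ = ⊥-elim (As≢[] refl)
scan-absorb {m} (A ∷ As) _ (Bs≤A ∷ _) with m <? max A
... | yes m<A = cong (max A ∷_) (scan-absorb-≤ As Bs≤A)
... | no m≮A = scan-absorb-≤ As (All.map (λ B≤A → ≤-trans B≤A (≮⇒≥ m≮A)) Bs≤A)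

max∈runs : ∀ xs {B} → B ∈ runs xs → max B ∈ xs
max∈runs xs {B} B∈ = subst (max B ∈_) (runs-word xs) (∈-word B∈ (max-∈ B))

All-reverse : ∀ {A : Set} {P : A → Set} {xs} → All P xs → All P (reverse xs)
All-reverse {xs = xs} = Perm.All-resp-↭ (↭-sym (Perm.↭-reverse xs))

max-∷⁺ : ∀ {x} B → x < max B → max (x ∷⁺ B) ≡ max B
max-∷⁺ {x} (y ∷ ys) x<B = trans (foldr₁-∷ _⊔_ x y ys) (m≤n⇒m⊔n≡n (<⇒≤ x<B))

runs-absorb : ∀ {x y xs} → y ∈ xs → (∀ {z} → z ∈ xs → x < z) →
  ∃₂ λ B Bs → runs xs ≡ B ∷ Bs × runs (x ∷ xs) ≡ (x ∷⁺ B) ∷ Bs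
runs-absorb {xs = y ∷ ys} _ x<xs with runs-head y ys
... | as , Bs , e = y ∷ as , Bs , e , runs-∷-< {ys = ys} (x<xs (here refl)) e

-- If the right subtree is nonempty, all runs of the left part are dominated and contribute nothing,
-- and b merges into the first run on the right without changing its maximum; so the scan sees only
-- r.
scan-runs : ∀ {t m} → Ordered t → (∀ {x} → x ∈ φ t → m < x) →
    scan m (reverse (runs (φ t))) ≡ records t
scan-runs leaf _ = refl
scan-runs {node l b leaf} {m} (node b<l _ _ ol _) m<t
  rewrite runs-++ (φ l) {b} {[]} b<l | reverse-++ (runs (φ l)) ((b ∷ []) ∷ []) with m <? b
... | yes _ = cong (b ∷_) (scan-runs ol b<l)
... | no m≮b = ⊥-elim (m≮b (m<t (∈-root l leaf)))
scan-runs {node l b r@(node rl c rr)} {m} (node b<l b<r l<r _ or) m<t = begin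
  scan m (reverse (runs (φ l ++ b ∷ φ r)))
    ≡⟨ cong (scan m ∘ reverse) (runs-++ (φ l) b<l) ⟩
  scan m (reverse (runs (φ l) ++ runs (b ∷ φ r)))
    ≡⟨ cong (scan m) (reverse-++ (runs (φ l)) (runs (b ∷ φ r))) ⟩
  scan m (reverse (runs (b ∷ φ r)) ++ reverse (runs (φ l)))
    ≡⟨ scan-absorb (reverse (runs (b ∷ φ r))) nonempty
        (All-reverse (All.tabulate λ {A} A∈ → All-reverse (All.tabulate λ {B} B∈ →
         <⇒≤ (l<maxA A∈ (max∈runs (φ l) B∈))))) ⟩
  scan m (reverse (runs (b ∷ φ r)))
    ≡⟨ scan-cong (reverse (runs (b ∷ φ r))) (reverse (runs (φ r))) same-max ⟩
  scan m (reverse (runs (φ r)))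
    ≡⟨ scan-runs or (m<t ∘ ∈-right l r) ⟩
  records r ∎
  where
  open ≡-Reasoning
  merged : ∃₂ λ B Bs → runs (φ r) ≡ B ∷ Bs × runs (b ∷ φ r) ≡ (b ∷⁺ B) ∷ Bs
  merged = runs-absorb (∈-root rl rr) b<r
  B = proj₁ merged
  Bs = proj₁ (proj₂ merged)
  runs-r : runs (φ r) ≡ B ∷ Bs
  runs-r = proj₁ (proj₂ (proj₂ merged))
  runs-br : runs (b ∷ φ r) ≡ (b ∷⁺ B) ∷ Bs
  runs-br = proj₂ (proj₂ (proj₂ merged))
  max∈r : ∀ {A} → A ∈ B ∷ Bs → max A ∈ φ r
  max∈r {A} A∈ = max∈runs (φ r) (subst (A ∈_) (sym runs-r) A∈)
  max-bB : max (b ∷⁺ B) ≡ max B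
  max-bB = max-∷⁺ B (b<r (max∈r (here refl)))
  same-max : map max (reverse (runs (b ∷ φ r))) ≡ map max (reverse (runs (φ r)))
  same-max rewrite runs-br | runs-r = trans (reverse-map max ((b ∷⁺ B) ∷ Bs))
    (trans (cong (λ k → reverse (k ∷ map max Bs)) max-bB) (sym (reverse-map max (B ∷ Bs))))
  l<maxA : ∀ {A x} → A ∈ runs (b ∷ φ r) → x ∈ φ l → x < max A
  l<maxA {A} A∈ x∈l with subst (A ∈_) runs-br A∈
  ... | here refl = subst (_ <_) (sym max-bB) (l<r x∈l (max∈r (here refl)))
  ... | there A∈Bs = l<r x∈l (max∈r (there A∈Bs))
  nonempty : reverse (runs (b ∷ φ r)) ≢ []
  nonempty e
    with trans (cong length (sym e)) (trans (length-reverse (runs (b ∷ φ r))) (cong length runs-br))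
  ... | ()

-- The deleted set stays fixed while the recursion descends, so it is a separate parameter; the two
-- hypotheses say that it meets `φ t` exactly in `records t`.
filter-residue : ∀ {t} {S : List ℕ} → Ordered t → (∀ {x} → x ∈ φ t → x ∈ S → x ∈ records t) →
  (∀ {x} → x ∈ records t → x ∈ S) → filter (_∉? S) (φ t) ≡ residue t
filter-residue leaf _ _ = refl
filter-residue {node l a leaf} {S} (node a<l _ _ ol _) S⇒ ⇒S = begin
  filter (_∉? S) (φ l ++ a ∷ []) ≡⟨ filter-++ (_∉? S) (φ l) (a ∷ []) ⟩
  filter (_∉? S) (φ l) ++ filter (_∉? S) (a ∷ []) ≡⟨ cong₂ _++_
     (filter-residue ol (λ x∈l x∈S → drop-a x∈l (S⇒ (∈-left l leaf x∈l) x∈S)) (⇒S ∘ there))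
         (filter-reject (_∉? S) (λ a∉S → a∉S (⇒S (here refl)))) ⟩
  residue l ++ [] ≡⟨ ++-identityʳ (residue l) ⟩
  residue l ∎
  where
  open ≡-Reasoning
  drop-a : ∀ {x} → x ∈ φ l → x ∈ a ∷ records l → x ∈ records l
  drop-a x∈l (here refl) = ⊥-elim (<-irrefl refl (a<l x∈l))
  drop-a _ (there x∈) = x∈
filter-residue {node l a r@(node _ _ _)} {S} (node _ a<r l<r _ or) S⇒ ⇒S = begin
  filter (_∉? S) (φ l ++ a ∷ φ r) ≡⟨ filter-++ (_∉? S) (φ l) (a ∷ φ r) ⟩
  filter (_∉? S) (φ l) ++ filter (_∉? S) (a ∷ φ r) ≡⟨ cong₂ _++_
    (filter-all (_∉? S)
        (All.tabulate λ x∈l x∈S → <-irrefl refl (l<r x∈l (records⊆ r (S⇒ (∈-left l r x∈l) x∈S)))))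
    (trans (filter-accept (_∉? S)
        (λ a∈S → <-irrefl refl (a<r (records⊆ r (S⇒ (∈-root l r) a∈S)))))
      (cong (a ∷_) (filter-residue or (S⇒ ∘ ∈-right l r) ⇒S))) ⟩
  φ l ++ a ∷ residue r ∎
  where open ≡-Reasoning

-- Peeling a word along its tree.

residue⊆ : ∀ t {x} → x ∈ residue t → x ∈ φ t
residue⊆ (node l a leaf) x∈ = ∈-left l leaf (residue⊆ l x∈)
residue⊆ (node l a r@(node _ _ _)) = Subset.++⁺ʳ (φ l) (Subset.∷⁺ʳ a (residue⊆ r))

-- The graph of `peel` without fuel, so that successive steps can be chained without counting
-- entries.
data Peels : List ℕ → List Block → Set where
  []   : Peels [] []
  step : ∀ {x xs bs} → let λ₁ = μ (x ∷ xs) (min (x ∷ xs)) in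
         Peels (filter (_∉? toList λ₁) (x ∷ xs)) bs → Peels (x ∷ xs) (λ₁ ∷ bs)

peels⇒peel : ∀ {ω bs n} → Peels ω bs → length ω ≤ n → peel n ω ≡ bs
peels⇒peel {n = zero} [] _ = refl
peels⇒peel {n = suc n} [] _ = refl
peels⇒peel {x ∷ xs} {n = suc n} (step p) (s≤s len≤n) = cong (_ ∷_) (peels⇒peel p
  (≤-trans (≤-pred
      (filter-notAll (_∉? toList (μ (x ∷ xs) (min (x ∷ xs)))) (x ∷ xs)
        (lose (min-∈ (x ∷ xs)) (λ min∉ → min∉ (here refl))))) len≤n))

-- Frees `step` from the cons cell and from the literal `min`: in use the word is a concatenation
-- whose minimum sits in the middle.
peels-step : ∀ {ω a B ω′ bs} → a ∈ ω → (∀ {x} → x ∈ ω → a ≤ x) → μ ω a ≡ B →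
  filter (_∉? toList B) ω ≡ ω′ → Peels ω′ bs → Peels ω (B ∷ bs)
peels-step {x ∷ xs} a∈ω a≤ω μ≡B filter≡ω′ p
  with ≤-antisym (min-≤ (x ∷ xs) a∈ω) (a≤ω (min-∈ (x ∷ xs)))
peels-step _ _ refl refl p | refl = step p

takeWhile-++ : ∀ {A : Set} {P : A → Set} (P? : Decidable P) {xs y ys} → All P xs → ¬ P y →
  takeWhile P? (xs ++ y ∷ ys) ≡ xs
takeWhile-++ P? {y = y} [] ¬Py rewrite dec-false (P? y) ¬Py = refl
takeWhile-++ P? {x ∷ xs} (Px ∷ Pxs) ¬Py rewrite dec-true (P? x) Px =
    cong (x ∷_) (takeWhile-++ P? Pxs ¬Py)

peels-attach : ∀ {l a v bs} → Ordered l → (∀ {x} → x ∈ φ l → a < x) → (∀ {y} → y ∈ v → a < y) →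
  (∀ {x y} → x ∈ φ l → y ∈ v → x < y) →
  Peels (residue l ++ v) bs → Peels (φ l ++ a ∷ v) ((a ∷ records l) ∷ bs)
peels-attach {l} {a} {v} ol a<l a<v l<v =
    peels-step (∈-++⁺ʳ (φ l) (here refl)) a≤ (cong (a ∷_) scanned) filtered
  where
  open ≡-Reasoning
  a≤ : ∀ {x} → x ∈ φ l ++ a ∷ v → a ≤ x
  a≤ x∈ with ∈-++⁻ (φ l) x∈
  ... | inj₁ x∈l = <⇒≤ (a<l x∈l)
  ... | inj₂ (here refl) = ≤-refl
  ... | inj₂ (there x∈v) = <⇒≤ (a<v x∈v)
  a∉runs : ∀ {B} → B ∈ runs (φ l) → a ∉ toList B
  a∉runs B∈ a∈B = <-irrefl refl (a<l (subst (a ∈_) (runs-word (φ l)) (∈-word B∈ a∈B)))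
  -- Being smaller than all of `φ l`, the label a begins a run, so the blocks to its left are
  -- precisely the runs of `φ l`.
  before : takeWhile (λ B → a ∉? toList B) (runs (φ l ++ a ∷ v)) ≡ runs (φ l)
  before with runs-head a v
  ... | as , Bs , e rewrite runs-++ (φ l) {a} {v} a<l | e =
      takeWhile-++ (λ B → a ∉? toList B) (All.tabulate a∉runs) (λ a∉ → a∉ (here refl))
  scanned : scan a (reverse (takeWhile (λ B → a ∉? toList B) (runs (φ l ++ a ∷ v)))) ≡ records l
  scanned = trans (cong (scan a ∘ reverse) before) (scan-runs ol a<l)
  S = a ∷ records l
  drop-a : ∀ {x} → x ∈ φ l → x ∈ S → x ∈ records l
  drop-a x∈l (here refl) = ⊥-elim (<-irrefl refl (a<l x∈l))
  drop-a _ (there x∈) = x∈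
  v∉S : ∀ {y} → y ∈ v → y ∉ S
  v∉S y∈v (here refl) = <-irrefl refl (a<v y∈v)
  v∉S y∈v (there y∈) = <-irrefl refl (l<v (records⊆ l y∈) y∈v)
  filtered : filter (_∉? S) (φ l ++ a ∷ v) ≡ residue l ++ v
  filtered = begin
    filter (_∉? S) (φ l ++ a ∷ v) ≡⟨ filter-++ (_∉? S) (φ l) (a ∷ v) ⟩
    filter (_∉? S) (φ l) ++ filter (_∉? S) (a ∷ v) ≡⟨ cong₂ _++_ (filter-residue ol drop-a there)
      (trans (filter-reject (_∉? S) (λ a∉S → a∉S (here refl)))
          (filter-all (_∉? S) (All.tabulate v∉S))) ⟩
    residue l ++ v ∎

<-++ : ∀ {xs ys zs : List ℕ} → (∀ {x y} → x ∈ xs → y ∈ ys → x < y) →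
    (∀ {x y} → x ∈ xs → y ∈ zs → x < y) →
  ∀ {x y} → x ∈ xs → y ∈ ys ++ zs → x < y
<-++ {ys = ys} xs<ys xs<zs x∈ y∈ = [ xs<ys x∈ , xs<zs x∈ ]′ (∈-++⁻ ys y∈)

-- Since t lies below u, its leftovers are used up before u is touched. Carrying the rest of the
-- word and its peeling as `u` and `bs` lets the inductions for l and r be nested.
peels-inner : ∀ {t u bs} → Ordered t → (∀ {x y} → x ∈ φ t → y ∈ u → x < y) →
  Peels u bs → Peels (residue t ++ u) (inner t ++ bs)
peels-inner leaf _ p = p
peels-inner {node l a leaf} (node _ _ _ ol _) t<u p = peels-inner ol (t<u ∘ ∈-left l leaf) p
peels-inner {node l a r@(node _ _ _)} {u} {bs} (node a<l a<r l<r ol or) t<u p =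
  subst₂ Peels (sym (++-assoc (φ l) (a ∷ residue r) u))
      (cong (_ ∷_) (sym (++-assoc (inner l) (inner r) bs)))
    (peels-attach ol a<l ([ a<r ∘ residue⊆ r , t<u (∈-root l r) ]′ ∘ ∈-++⁻ (residue r)) l<
      (peels-inner ol l< (peels-inner or (t<u ∘ ∈-right l r) p)))
  where
  l< : ∀ {x y} → x ∈ φ l → y ∈ residue r ++ u → x < y
  l< = <-++ (λ x∈ y∈ → l<r x∈ (residue⊆ r y∈)) (t<u ∘ ∈-left l r)

peels-dual : ∀ {t u bs} → Ordered t → (∀ {x y} → x ∈ φ t → y ∈ u → x < y) →
  Peels u bs → Peels (φ t ++ u) (dual t ++ bs)
peels-dual leaf _ p = p
peels-dual {node l a r} {u} {bs} (node a<l a<r l<r ol or) t<u p =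
  subst₂ Peels (sym (++-assoc (φ l) (a ∷ φ r) u))
      (cong (_ ∷_) (sym (++-assoc (inner l) (dual r) bs)))
    (peels-attach ol a<l ([ a<r , t<u (∈-root l r) ]′ ∘ ∈-++⁻ (φ r)) l<
      (peels-inner ol l< (peels-dual or (t<u ∘ ∈-right l r) p)))
  where
  l< : ∀ {x y} → x ∈ φ l → y ∈ φ r ++ u → x < y
  l< = <-++ l<r (t<u ∘ ∈-left l r)

β-φ : ∀ {t} → Ordered t → β (φ t) ≡ reverse (dual t)
β-φ {t} o = cong reverse (peels⇒peel
  (subst₂ Peels (++-identityʳ (φ t)) (++-identityʳ (dual t)) (peels-dual o (λ _ ()) [])) ≤-refl)

-- The sorted chains and their Kreweras complement.

open InsertionSort (On.decTotalOrder (Flip.decTotalOrder ≤-decTotalOrder) min)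
  using (sort-↭; sort-↗)

-- (a , b] is the difference of the unseparated intervals (a , c] and (b , d].
dual-nonCrossing : ∀ {t} → Ordered t → (∀ {x} → x ∈ φ t → 0 < x) →
    NonCrossingPairs (SameBlock (dual t))
dual-nonCrossing {t} o 0<t {a} {b} {c} {d} a<b b<c c<d ac bd =
  from (dual⇔unseparated o 0<t (proj₁ (⊆φ ac)) (proj₁ (⊆φ bd)) (<⇒≤ a<b)) ab
  where
  open Equivalence
  ⊆φ : ∀ {x y} → SameBlock (dual t) x y → x ∈ φ t × y ∈ φ t
  ⊆φ s =
    let x∈ , y∈ = sameBlock⇒∈ s
    in Perm.∈-resp-↭ (dual-↭ t) x∈ , Perm.∈-resp-↭ (dual-↭ t) y∈
  uns : ∀ {i j} → i < j → SameBlock (dual t) i j → Unseparated (SameBlock (chains t)) i j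
  uns i<j s = to (dual⇔unseparated o 0<t (proj₁ (⊆φ s)) (proj₂ (⊆φ s)) (<⇒≤ i<j)) s
  ab : Unseparated (SameBlock (chains t)) a b
  ab xy a<x x≤b =
    let a<y , y≤c = uns (<-trans a<b b<c) ac xy a<x (≤-trans x≤b (<⇒≤ b<c))
    in a<y , ≮⇒≥
        (λ b<y → ≤⇒≯ x≤b
          (proj₁ (uns (<-trans b<c c<d) bd (sameBlock-sym xy) b<y (≤-trans y≤c (<⇒≤ c<d)))))

ψ-isNCP : ∀ {n t} → Ordered t → φ t ↭ [ n ]₁ → IsNCP n (ψ t)
ψ-isNCP {n} {t} o p = isNCP (↭-trans (word-↭ ψ↭) (↭-trans (chains-↭ t) p))
  (Perm.All-resp-↭ (↭-sym ψ↭) (chains-increasing o)) (sort-↗ (chains t))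
  λ a<b b<c c<d ac bd → Perm.Any-resp-↭ (↭-sym ψ↭)
    (chains-nonCrossing o a<b b<c c<d (Perm.Any-resp-↭ ψ↭ ac) (Perm.Any-resp-↭ ψ↭ bd))
  where
  ψ↭ : ψ t ↭ chains t
  ψ↭ = sort-↭ (chains t)

labels-pos : ∀ {n t} → φ t ↭ [ n ]₁ → ∀ {x} → x ∈ φ t → 0 < x
labels-pos {n} p x∈ with ∈-applyUpTo⁻ suc {n = n} (Perm.∈-resp-↭ p x∈)
... | _ , _ , refl = z<s

reverse-dual-isNCP : ∀ {n t} → Ordered t → φ t ↭ [ n ]₁ → IsNCP n (reverse (dual t))
reverse-dual-isNCP {n} {t} o p = isNCP
  (↭-trans (word-↭ (Perm.↭-reverse (dual t))) (↭-trans (dual-↭ t) p))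
  (All-reverse (dual-increasing o))
  (Linked.AllPairs⇒Linked (AllPairs.map <⇒≤ (AllPairs-reverse (dual-sorted o))))
  λ a<b b<c c<d ac bd → Any.reverse⁺
    (dual-nonCrossing o (labels-pos {t = t} p) a<b b<c c<d (Any.reverse⁻ ac) (Any.reverse⁻ bd))

krewerasComplement : ∀ {n t} → Ordered t → φ t ↭ [ n ]₁ →
    KrewerasComplement n (ψ t) (reverse (dual t))
krewerasComplement {n} {t} o p = record
  { source = ψ-isNCP o p
  ; target = reverse-dual-isNCP o p
  ; blocks = λ {i} {j} i∈ j∈ →
      [ blocks-≤ i∈ j∈
      , (λ j≤i → let e = blocks-≤ j∈ i∈ j≤i in
          mk⇔ (sameRegion-sym ∘ to e ∘ sameBlock-sym) (sameBlock-sym ∘ from e ∘ sameRegion-sym))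
      ]′ (≤-total i j)
  }
  where
  open Equivalence
  ψ↭ : ψ t ↭ chains t
  ψ↭ = sort-↭ (chains t)
  blocks-≤ : ∀ {i j} → i ∈ [ n ]₁ → j ∈ [ n ]₁ → i ≤ j →
    SameBlock (reverse (dual t)) i j ⇔ SameRegion (ψ t) (primed i) (primed j)
  blocks-≤ {i} {j} i∈ j∈ i≤j = mk⇔
    (λ s → from geometric λ xy → to combinatorial (Any.reverse⁻ s) (Perm.Any-resp-↭ ψ↭ xy))
    (λ r → Any.reverse⁺
        (from combinatorial λ xy → to geometric r (Perm.Any-resp-↭ (↭-sym ψ↭) xy)))
    where
    combinatorial = dual⇔unseparated {t} {i} {j} o (labels-pos {t = t} p)
      (Perm.∈-resp-↭ (↭-sym p) i∈) (Perm.∈-resp-↭ (↭-sym p) j∈) i≤j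
    geometric : SameRegion (ψ t) (primed i) (primed j) ⇔ Unseparated (SameBlock (ψ t)) i j
    geometric = sameRegion⇔unseparated i≤j

proposition3p41 : (n : ℕ) → 1 ≤ n → (π : List Block) → IsNCCP312 n π →
    KrewerasComplement n (ψ (φ⁻¹ (word π))) (β (word π))
proposition3p41 n _ π h =
    subst (KrewerasComplement n (ψ t)) (sym β≡) (krewerasComplement o labels)
  where
  open IsNCCP312 h
  open IsNCCP isNCCP using (partition)
  open IsLabeledTree (φ⁻¹-isLabeledTree partition)
  t = φ⁻¹ (word π)
  φt≡w : φ t ≡ word π
  φt≡w = φ∘φ⁻¹ (word π)
  o : Ordered t
  o = avoids312⇒ordered increasing (Unique-resp-↭ (↭-sym labels) ([n]-unique n))
      (subst Avoids312 (sym φt≡w) avoids312)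
  β≡ : β (word π) ≡ reverse (dual t)
  β≡ = trans (cong β (sym φt≡w)) (β-φ o)
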